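{- For any integers $2\le s\le t$, $\mathrm{ex}(n,K'_{s,t})=O(n^{3/2-\frac{1}{2s}})$ as $n\to\infty$, where the implied constant may depend on $s$ and $t$.
   Context: For a graph $H$, $\mathrm{ex}(n,H)$ is the maximum number of edges in an $n$-vertex graph containing no copy of $H$ as a subgraph. $K'_{s,t}$ denotes the 1-subdivision of the complete bipartite graph $K_{s,t}$, i.e. the graph obtained by replacing the edges of $K_{s,t}$ by internally disjoint paths of length 2. -}

module Defs where

open import Level using (0ℓ)
open import Data.Nat.Base as ℕ using (ℕ; suc; _≤_; _*_; _^_; NonZero; z≤n)
import Data.Nat.Properties as ℕ
open import Data.Integer.Base using (+_; -[1+_])
open import Data.Rational.Unnormalised.Base using (ℚᵘ; mkℚᵘ)
open import Data.Fin.Base using (Fin; zero; suc; combine; finToFun; funToFin)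
import Data.Fin.Properties as Fin
open import Data.List.Base using (List; length; filter; map; tabulate; allFin; cartesianProduct)
import Data.List.Properties as List
open import Data.List.Extrema.Nat using (max; xs≤max; argmax-sel)
open import Data.List.Membership.Propositional using (_∈_)
open import Data.List.Membership.Propositional.Properties
  using (∈-map⁺; ∈-map⁻; ∈-filter⁺; ∈-filter⁻; ∈-tabulate⁺)
import Data.List.Relation.Unary.All as All
open import Data.Product.Base using (∃; ∃-syntax; _×_; _,_; proj₁; proj₂)
open import Data.Sum.Base using (_⊎_; inj₁; inj₂; swap)
open import Data.Sum.Function.Propositional using (_⊎-↔_)
open import Function.Base using (id; _∘_)
open import Function.Bundles using (_↔_; Inverse)
open import Function.Construct.Composition using (_↔-∘_)
open import Function.Construct.Symmetry using (↔-sym)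
open import Function.Definitions using (Injective)
open import Relation.Binary.Core using (Rel)
open import Relation.Binary.Definitions using (Symmetric; Irreflexive; Decidable)
open import Relation.Binary.PropositionalEquality
open import Relation.Nullary using (¬_; Dec; yes; no; ¬?; map′; _×-dec_; _⊎-dec_; _→-dec_)

------------------------------------------------------------------------
-- Graphs

record Graph (V : Set) : Set₁ where
  field
    _~_    : Rel V 0ℓ
    ~-sym  : Symmetric _~_
    ~-irr  : Irreflexive _≡_ _~_
    _~?_   : Decidable _~_

record FiniteGraph : Set₁ where
  field
    Vertex      : Set
    order       : ℕ
    enumeration : Vertex ↔ Fin order
    graph       : Graph Vertex

-- Each edge is counted once, as the ordered pair with smaller first entry.
edges : ∀ {n} → Graph (Fin n) → ℕ
edges {n} G =
  length (filter (λ (i , j) → (i Fin.<? j) ×-dec (i ~? j))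
                 (cartesianProduct (allFin n) (allFin n)))
  where open Graph G

-- Copies are not required to be induced.
record Copy {V W : Set} (H : Graph V) (G : Graph W) : Set where
  private
    module H = Graph H
    module G = Graph G
  field
    embed     : V → W
    injective : Injective _≡_ _≡_ embed
    preserves : ∀ {u v} → u H.~ v → embed u G.~ embed v

_FreeOf_ : ∀ {V W} → Graph W → Graph V → Set
G FreeOf H = ¬ Copy H G

copy? : ∀ (H : FiniteGraph) {n} (G : Graph (Fin n)) → Dec (Copy (FiniteGraph.graph H) G)
copy? H {n} G = map′ sound complete (Fin.any? (λ k → good? (finToFun k)))
  where
  open FiniteGraph H
  open Inverse enumeration using (to; from; strictlyInverseˡ; strictlyInverseʳ)
  module H = Graph graph
  module G = Graph G

  Good : (Fin order → Fin n) → Set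
  Good f = (∀ a b → f a ≡ f b → a ≡ b) × (∀ a b → from a H.~ from b → f a G.~ f b)

  good? : ∀ f → Dec (Good f)
  good? f = Fin.all? (λ a → Fin.all? (λ b → (f a Fin.≟ f b) →-dec (a Fin.≟ b)))
      ×-dec Fin.all? (λ a → Fin.all? (λ b → (from a H.~? from b) →-dec (f a G.~? f b)))

  sound : ∃ (λ k → Good (finToFun k)) → Copy graph G
  sound (k , inj , pres) = record
    { embed     = finToFun k ∘ to
    ; injective = λ {u} {v} eq → trans (sym (strictlyInverseʳ u))
                    (trans (cong from (inj (to u) (to v) eq)) (strictlyInverseʳ v))
    ; preserves = λ {u} {v} u~v → pres (to u) (to v)
                    (subst₂ H._~_ (sym (strictlyInverseʳ u)) (sym (strictlyInverseʳ v)) u~v)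
    }

  complete : Copy graph G → ∃ (λ k → Good (finToFun k))
  complete c = funToFin f
    , (λ a b eq → trans (sym (strictlyInverseˡ a))
                    (trans (cong to (injective (trans (sym (f≗ a)) (trans eq (f≗ b)))))
                      (strictlyInverseˡ b)))
    , (λ a b a~b → subst₂ G._~_ (sym (f≗ a)) (sym (f≗ b)) (preserves a~b))
    where
    open Copy c
    f : Fin order → Fin n
    f = embed ∘ from
    f≗ : finToFun (funToFin f) ≗ f
    f≗ = Fin.finToFun-funToFin f

------------------------------------------------------------------------
-- Extremal numbers

-- A code k lists the n² entries of a 0-1 matrix; the graph joins i ≢ j when
-- the (i , j) or the (j , i) entry is 1.
decode : ∀ n → Fin (2 ^ (n * n)) → Graph (Fin n)
decode n k = record
  { _~_   = λ i j → ¬ (i ≡ j) × (bit i j ≡ suc zero ⊎ bit j i ≡ suc zero)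
  ; ~-sym = λ (i≢j , b) → (i≢j ∘ sym) , swap b
  ; ~-irr = λ i≡j (i≢j , _) → i≢j i≡j
  ; _~?_  = λ i j → ¬? (i Fin.≟ j)
              ×-dec ((bit i j Fin.≟ suc zero) ⊎-dec (bit j i Fin.≟ suc zero))
  }
  where
  bit : Fin n → Fin n → Fin 2
  bit i j = finToFun k (combine i j)

graphs : ∀ n → List (Graph (Fin n))
graphs n = tabulate (decode n)

-- The default value 0 is relevant only if no n-vertex graph is H-free;
-- otherwise ex-attained and ex-upper characterise ex n H.
ex : ℕ → FiniteGraph → ℕ
ex n H = max 0 (map edges (filter (λ G → ¬? (copy? H G)) (graphs n)))

private
  module _ {n} (G : Graph (Fin n)) where
    open Graph G

    matrix : Fin n × Fin n → Fin 2
    matrix (i , j) with i ~? j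
    ... | yes _ = suc zero
    ... | no  _ = zero

    matrix⁺ : ∀ {i j} → i ~ j → matrix (i , j) ≡ suc zero
    matrix⁺ {i} {j} p with i ~? j
    ... | yes _ = refl
    ... | no ¬p with () ← ¬p p

    matrix⁻ : ∀ {i j} → matrix (i , j) ≡ suc zero → i ~ j
    matrix⁻ {i} {j} eq with i ~? j | eq
    ... | yes p | _ = p
    ... | no  _ | ()

    entries : Fin (n * n) → Fin 2
    entries = matrix ∘ Inverse.to (Fin.*↔× {n} {n})

    code : Fin (2 ^ (n * n))
    code = funToFin entries

    bit≡ : ∀ i j → finToFun {2} {n * n} code (combine i j) ≡ matrix (i , j)
    bit≡ i j = trans (Fin.finToFun-funToFin entries (combine i j))
                     (cong matrix (Fin.remQuot-combine i j))

    module D = Graph (decode n code)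

    code⁺ : ∀ {i j} → i ~ j → i D.~ j
    code⁺ {i} {j} p = (λ i≡j → ~-irr i≡j p) , inj₁ (trans (bit≡ i j) (matrix⁺ p))

    code⁻ : ∀ {i j} → i D.~ j → i ~ j
    code⁻ {i} {j} (_ , inj₁ e) = matrix⁻ (trans (sym (bit≡ i j)) e)
    code⁻ {i} {j} (_ , inj₂ e) = ~-sym (matrix⁻ (trans (sym (bit≡ j i)) e))

    edges-code : edges (decode n code) ≡ edges G
    edges-code = cong length
      (List.filter-≐ _ _ ((λ (lt , p) → lt , code⁻ p) , (λ (lt , p) → lt , code⁺ p))
        (cartesianProduct (allFin n) (allFin n)))

ex-upper : ∀ {n} (H : FiniteGraph) (G : Graph (Fin n)) →
           G FreeOf FiniteGraph.graph H → edges G ≤ ex n H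
ex-upper {n} H G free = subst (_≤ ex n H) (edges-code G)
  (All.lookup (xs≤max 0 _)
    (∈-map⁺ edges (∈-filter⁺ (λ G → ¬? (copy? H G)) (∈-tabulate⁺ (code G))
      (λ c → free (record { embed     = Copy.embed c
                          ; injective = Copy.injective c
                          ; preserves = code⁻ G ∘ Copy.preserves c })))))

ex-attained : ∀ {n} (H : FiniteGraph) (G₀ : Graph (Fin n)) → G₀ FreeOf FiniteGraph.graph H →
              ∃[ G ] (G FreeOf FiniteGraph.graph H × edges {n} G ≡ ex n H)
ex-attained {n} H G₀ free₀
  with argmax-sel id 0 (map edges (filter (λ G → ¬? (copy? H G)) (graphs n)))
... | inj₁ ex≡0 = G₀ , free₀ ,
      ℕ.≤-antisym (ex-upper H G₀ free₀) (subst (_≤ edges G₀) (sym ex≡0) z≤n)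
... | inj₂ ex∈ with G , G∈ , ex≡ ← ∈-map⁻ edges ex∈ =
      G , proj₂ (∈-filter⁻ (λ G → ¬? (copy? H G)) {xs = graphs n} G∈) , sym ex≡

------------------------------------------------------------------------
-- The 1-subdivision of the complete bipartite graph

-- K_{s,t} has vertex set Fin s ⊎ Fin t, and one edge (i , j) for each
-- i : Fin s and j : Fin t, with ends inj₁ i and inj₂ j.
data _EndOf_ {s t : ℕ} : Fin s ⊎ Fin t → Fin s × Fin t → Set where
  left  : ∀ {i j} → inj₁ i EndOf (i , j)
  right : ∀ {i j} → inj₂ j EndOf (i , j)

-- inj₂ e is the midpoint of the path of length 2 that replaces the edge e.
SubdivisionVertex : ℕ → ℕ → Set
SubdivisionVertex s t = (Fin s ⊎ Fin t) ⊎ (Fin s × Fin t)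

data SubdivisionAdj {s t : ℕ} : Rel (SubdivisionVertex s t) 0ℓ where
  to-mid   : ∀ {v e} → v EndOf e → SubdivisionAdj (inj₁ v) (inj₂ e)
  from-mid : ∀ {v e} → v EndOf e → SubdivisionAdj (inj₂ e) (inj₁ v)

endOf? : ∀ {s t} (v : Fin s ⊎ Fin t) (e : Fin s × Fin t) → Dec (v EndOf e)
endOf? (inj₁ i) (i′ , j) = map′ (λ { refl → left }) (λ { left → refl }) (i Fin.≟ i′)
endOf? (inj₂ j) (i , j′) = map′ (λ { refl → right }) (λ { right → refl }) (j Fin.≟ j′)

subdivisionAdj? : ∀ {s t} → Decidable (SubdivisionAdj {s} {t})
subdivisionAdj? (inj₁ _) (inj₁ _) = no λ ()
subdivisionAdj? (inj₁ v) (inj₂ e) = map′ to-mid (λ { (to-mid p) → p }) (endOf? v e)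
subdivisionAdj? (inj₂ e) (inj₁ v) = map′ from-mid (λ { (from-mid p) → p }) (endOf? v e)
subdivisionAdj? (inj₂ _) (inj₂ _) = no λ ()

K′ : ℕ → ℕ → FiniteGraph
K′ s t = record
  { Vertex      = SubdivisionVertex s t
  ; order       = (s ℕ.+ t) ℕ.+ s * t
  ; enumeration = ↔-sym ((Fin.+↔⊎ {s} {t} ⊎-↔ Fin.*↔× {s} {t}) ↔-∘ Fin.+↔⊎)
  ; graph       = record
    { _~_   = SubdivisionAdj
    ; ~-sym = λ { (to-mid p) → from-mid p ; (from-mid p) → to-mid p }
    ; ~-irr = λ { refl () }
    ; _~?_  = subdivisionAdj?
    }
  }

------------------------------------------------------------------------
-- Growth rates with rational exponent

-- x ≤ C · n ^ α for n ≥ 1, with the real power n ^ (p / q) eliminated by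
-- raising both sides to the q-th power (mkℚᵘ p d has denominator suc d),
-- and a negative power of n moved to the other side.
_≤_·_^^_ : ℕ → ℕ → ℕ → ℚᵘ → Set
x ≤ C · n ^^ mkℚᵘ (+ p) d    = x ^ suc d ≤ C ^ suc d * n ^ p
x ≤ C · n ^^ mkℚᵘ -[1+ p ] d = x ^ suc d * n ^ suc p ≤ C ^ suc d

-- f(n) = O(n ^ α) as n → ∞.  A natural number constant is no restriction,
-- since a real constant can be rounded up.
_=O[n^_] : (ℕ → ℕ) → ℚᵘ → Set
f =O[n^ α ] = ∃[ C ] ∃[ N ] (∀ n → N ≤ n → f n ≤ C · n ^^ α)

2*-nonZero : ∀ {s} → 2 ≤ s → NonZero (2 * s)
2*-nonZero {suc _} _ = _

{-# OPTIONS --safe #-}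

-- Pass to a set of N ≤ n vertices in which every degree is at least d, where
-- d is of order e(G) / n and d ^ (2 s) exceeds a large multiple of n ^ (s - 1).
-- A spider is a centre y with s legs y ~ mᵢ ~ xᵢ; keeping d neighbours of each
-- vertex leaves N d ^ (2 s) of them, so some tuple of ends (x₁, …, xₛ) is shared
-- by many.  Pairwise disjoint spiders with the same distinct ends form a
-- subdivided K_{s,t}, and can be chosen greedily if every vertex meets boundedly
-- many of the spiders with the given ends.  This holds for good spiders: the
-- pairs (y, xᵢ) and (mᵢ, mⱼ) have bounded codegree, and no mᵢ is the midpoint of
-- many such spiders having the other s - 1 ends in common.  Finally, fix all
-- legs of a spider but one: only a small proportion of the choices for the last
-- leg is bad, because otherwise vertices of large codegree, or midpoints of many
-- spiders, can be embedded greedily as a subdivided K_{s,t}.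

module Submission where

open import Defs
open import Data.Nat.Base using (ℕ; _≤_; _*_)
open import Data.Integer.Base using (+_)
open import Data.Rational.Unnormalised.Base using (_/_; _-_)
open import Data.Nat.Base
  using (zero; suc; _<_; _+_; _^_; _∸_; z≤n; s≤s; NonZero; >-nonZero; >-nonZero⁻¹)
open import Data.Nat.Properties
open import Data.Fin.Base using (Fin; zero; suc; punchIn; punchOut)
import Data.Fin.Properties as Fin
open import Data.List.Base
  using (List; []; _∷_; _++_; length; map; filter; allFin; take; cartesianProduct)
import Data.List.Properties as List
open import Data.List.Membership.Propositional using (_∈_; _∉_; find; lose)
open import Data.List.Membership.Propositional.Properties
open import Data.List.Relation.Unary.All as All using (All; []; _∷_)
import Data.List.Relation.Unary.All.Properties as All
open import Data.List.Relation.Unary.Any using (Any; here; there; any?; satisfied)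
open import Data.List.Relation.Unary.AllPairs using ([]; _∷_)
open import Data.List.Relation.Unary.Unique.Propositional using (Unique)
import Data.List.Relation.Unary.Unique.Propositional.Properties as Unique
open import Data.Vec.Base as Vec using (Vec; []; _∷_; lookup; removeAt; insertAt; replicate)
import Data.Vec.Properties as Vec
import Data.Vec.Membership.Propositional.Properties as Vec
open import Data.Product.Base using (∃-syntax; _×_; _,_; proj₁; proj₂; uncurry)
open import Data.Sum.Base as Sum using (_⊎_; inj₁; inj₂)
open import Data.Empty using (⊥; ⊥-elim)
open import Function.Base using (_∘_; id; case_of_)
open import Relation.Binary.Definitions using (DecidableEquality)
open import Relation.Binary.PropositionalEquality
open import Relation.Nullary
open import Relation.Unary using (Decidable)
open import Data.Nat.Tactic.RingSolver using (solve-∀)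
import Data.Nat.DivMod as DivMod

-- Counting by covering lists

-- An upper bound on the number of elements with `P`, which need not be decidable. The list may
-- repeat elements or contain others, so unions, products and images require neither disjointness
-- nor injectivity.
record Cover {A : Set} (P : A → Set) (b : ℕ) : Set where
  constructor mkCover
  field
    list   : List A
    bound  : length list ≤ b
    covers : ∀ {a} → P a → a ∈ list

module _ {A : Set} where

  unique-⊆ : ∀ {xs ys : List A} → Unique xs → (∀ {x} → x ∈ xs → x ∈ ys) →
             length xs ≤ length ys
  unique-⊆ {[]}     _         _     = z≤n
  unique-⊆ {x ∷ xs} (x∉ ∷ u) xs⊆ys with as , bs , refl ← ∈-∃++ (xs⊆ys (here refl)) =
    subst (suc (length xs) ≤_) (sym (List.length-++-sucʳ as x bs)) (s≤s (unique-⊆ u rest))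
    where
    rest : ∀ {z} → z ∈ xs → z ∈ as ++ bs
    rest z∈ with ∈-++⁻ as (xs⊆ys (there z∈))
    ... | inj₁ z∈as             = ∈-++⁺ˡ z∈as
    ... | inj₂ (here refl)      with () ← All.lookup x∉ z∈ refl
    ... | inj₂ (there z∈bs)     = ∈-++⁺ʳ as z∈bs

  cover-weaken : ∀ {P : A → Set} {b c} → b ≤ c → Cover P b → Cover P c
  cover-weaken b≤c (mkCover l l≤ P⊆) = mkCover l (≤-trans l≤ b≤c) P⊆

  cover-⊆ : ∀ {P Q : A → Set} {b} → (∀ {a} → P a → Q a) → Cover Q b → Cover P b
  cover-⊆ P⊆Q (mkCover l l≤ Q⊆) = mkCover l l≤ (Q⊆ ∘ P⊆Q)

  cover-∪ : ∀ {P Q : A → Set} {b c} → Cover P b → Cover Q c →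
            Cover (λ a → P a ⊎ Q a) (b + c)
  cover-∪ (mkCover l l≤ P⊆) (mkCover r r≤ Q⊆) = mkCover (l ++ r)
    (subst (_≤ _) (sym (List.length-++ l)) (+-mono-≤ l≤ r≤))
    (Sum.[ ∈-++⁺ˡ ∘ P⊆ , ∈-++⁺ʳ l ∘ Q⊆ ])

  cover-∈ : (xs : List A) → Cover (_∈ xs) (length xs)
  cover-∈ xs = mkCover xs ≤-refl id

  cover-∃∈ : ∀ {B : Set} {P : B → A → Set} {b} (us : List B) →
             (∀ {u} → u ∈ us → Cover (P u) b) →
             Cover (λ a → ∃[ u ] (u ∈ us × P u a)) (length us * b)
  cover-∃∈ []       _ = mkCover [] z≤n λ ()
  cover-∃∈ (u ∷ us) c =
    cover-⊆ (λ { (_ , here refl , p) → inj₁ p ; (v , there v∈ , p) → inj₂ (v , v∈ , p) })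
      (cover-∪ (c (here refl)) (cover-∃∈ us (c ∘ there)))

  cover-∃Fin : ∀ {k b} {P : Fin k → A → Set} → (∀ i → Cover (P i) b) →
               Cover (λ a → ∃[ i ] P i a) (k * b)
  cover-∃Fin {k} {b} c = cover-weaken (≤-reflexive (cong (_* b) (List.length-tabulate {n = k} id)))
    (cover-⊆ (λ (i , p) → i , ∈-allFin i , p) (cover-∃∈ (allFin k) (λ {i} _ → c i)))

  unique-bound : ∀ {P : A → Set} {b xs} → Unique xs → (∀ {x} → x ∈ xs → P x) → Cover P b →
                 length xs ≤ b
  unique-bound u xs⊆P (mkCover l l≤ P⊆) = ≤-trans (unique-⊆ u (P⊆ ∘ xs⊆P)) l≤

  length-partition : ∀ {P : A → Set} (P? : Decidable P) xs →
    length xs ≡ length (filter P? xs) + length (filter (¬? ∘ P?) xs)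
  length-partition P? [] = refl
  length-partition P? (x ∷ xs) with P? x
  ... | yes p = cong suc (length-partition P? xs)
  ... | no ¬p = trans (cong suc (length-partition P? xs)) (sym (+-suc _ _))

  survivors : ∀ {P : A → Set} (P? : Decidable P) {b xs} → Unique xs →
              Cover (λ x → x ∈ xs × P x) b → length xs ≤ b + length (filter (¬? ∘ P?) xs)
  survivors P? {b} {xs} u c = subst (_≤ b + length (filter (¬? ∘ P?) xs))
    (sym (length-partition P? xs))
    (+-monoˡ-≤ _ (unique-bound (Unique.filter⁺ P? u) (∈-filter⁻ P?) c))

  -- The form of every greedy choice below: more candidates than forbidden ones leave a permitted
  -- one.
  survivor : ∀ {P : A → Set} (P? : Decidable P) {b xs} → Unique xs →
             Cover (λ x → x ∈ xs × P x) b → b < length xs → ∃[ x ] (x ∈ xs × ¬ P x)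
  survivor P? {b} {xs} u c b< with filter (¬? ∘ P?) xs in eq | survivors P? u c
  ... | []    | le with () ← <⇒≱ b< (subst (length xs ≤_) (+-identityʳ b) le)
  ... | x ∷ _ | _  = x , ∈-filter⁻ (¬? ∘ P?) (subst (x ∈_) (sym eq) (here refl))

  -- If no fibre over `ys` had more than `M` elements, the fibres together would cover `xs` with at
  -- most `length ys * M` entries.
  pigeonhole : ∀ {B : Set} (_≟_ : DecidableEquality B) (f : A → B) {xs ys M} → Unique xs →
               (∀ {x} → x ∈ xs → f x ∈ ys) → length ys * M < length xs →
               ∃[ b ] (M < length (filter (λ x → f x ≟ b) xs))
  pigeonhole _≟_ f {xs} {ys} {M} u f∈ lt
    with any? (λ b → M <? length (filter (λ x → f x ≟ b) xs)) ys
  ... | yes p = satisfied p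
  ... | no ¬p with () ← <⇒≱ lt (unique-bound {P = λ x → ∃[ b ] (b ∈ ys × x ∈ xs × f x ≡ b)} u
          (λ {x} x∈ → f x , f∈ x∈ , x∈ , refl)
          (cover-∃∈ ys (λ {b} b∈ → mkCover (filter (λ x → f x ≟ b) xs)
            (≮⇒≥ (All.lookup (All.¬Any⇒All¬ ys ¬p) b∈))
            (uncurry (∈-filter⁺ (λ x → f x ≟ b))))))

-- When `P` fails there is nothing to cover, so the bound on `Q` may be proved under the assumption
-- `P`.
cover-guard : ∀ {A P : Set} {Q : A → Set} {b} → Dec P → (P → Cover Q b) → Cover (λ a → P × Q a) b
cover-guard (yes p) c = cover-⊆ proj₂ (c p)
cover-guard (no ¬p) c = mkCover [] z≤n λ (p , _) → ⊥-elim (¬p p)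

-- Counting by a parametrisation: it suffices that each element of `Q` arises from some parameter
-- satisfying `P`.
cover-image : ∀ {A B : Set} {P : A → Set} {Q : B → Set} {b} (f : A → B) →
              (∀ {y} → Q y → ∃[ x ] (f x ≡ y × P x)) → Cover P b → Cover Q b
cover-image f Q⊆ (mkCover l l≤ P⊆) = mkCover (map f l)
  (subst (_≤ _) (sym (List.length-map f l)) l≤)
  (λ q → case Q⊆ q of λ { (x , refl , p) → ∈-map⁺ f (P⊆ p) })

cover-Σ : ∀ {A B : Set} {P : A → Set} {Q : A → B → Set} {b c} → Cover P b →
          (∀ a → Cover (Q a) c) → Cover (λ (a , x) → P a × Q a x) (b * c)
cover-Σ {Q = Q} {c = c} (mkCover l l≤ P⊆) cQ = cover-weaken (*-monoˡ-≤ c l≤)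
  (cover-⊆ (λ {(a , x)} (p , q) → a , P⊆ p , refl , q)
    (cover-∃∈ {P = λ a (a′ , x) → a′ ≡ a × Q a x} l
      (λ {a} _ → cover-image (a ,_) (λ { {_ , x} (refl , q) → x , refl , q }) (cQ a))))

cover-Vec : ∀ {A : Set} {k b} {P : Fin k → A → Set} → (∀ i → Cover (P i) b) →
            Cover (λ (v : Vec A k) → ∀ i → P i (lookup v i)) (b ^ k)
cover-Vec {k = zero}  _ = mkCover ([] ∷ []) ≤-refl λ { {[]} _ → here refl }
cover-Vec {k = suc k} c = cover-image (uncurry _∷_)
  (λ { {x ∷ v} p → (x , v) , refl , p zero , (p ∘ suc) })
  (cover-Σ (c zero) (λ _ → cover-Vec (c ∘ suc)))

-- Enumerating dependent pairs and choice vectors.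

sigma : ∀ {A B : Set} → List A → (A → List B) → List (A × B)
sigma []       f = []
sigma (a ∷ as) f = map (a ,_) (f a) ++ sigma as f

module _ {A B : Set} {f : A → List B} where

  ∈-sigma⁺ : ∀ {as a b} → a ∈ as → b ∈ f a → (a , b) ∈ sigma as f
  ∈-sigma⁺ {a ∷ as} (here refl) b∈ = ∈-++⁺ˡ (∈-map⁺ _ b∈)
  ∈-sigma⁺ {a ∷ as} (there a∈)  b∈ = ∈-++⁺ʳ _ (∈-sigma⁺ a∈ b∈)

  ∈-sigma⁻ : ∀ as {a b} → (a , b) ∈ sigma as f → a ∈ as × b ∈ f a
  ∈-sigma⁻ (a′ ∷ as) ab∈ with ∈-++⁻ (map (a′ ,_) (f a′)) ab∈
  ... | inj₁ q with _ , b∈ , refl ← ∈-map⁻ _ q = here refl , b∈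
  ... | inj₂ q with a∈ , b∈ ← ∈-sigma⁻ as q = there a∈ , b∈

  sigma-unique : ∀ {as} → Unique as → (∀ a → Unique (f a)) → Unique (sigma as f)
  sigma-unique {[]}     []       uf = []
  sigma-unique {a ∷ as} (a∉ ∷ u) uf = Unique.++⁺ (Unique.map⁺ (λ { refl → refl }) (uf a))
    (sigma-unique u uf) λ (p , q) → case ∈-map⁻ _ p of λ
      { (_ , _ , refl) → All.lookup a∉ (proj₁ (∈-sigma⁻ as q)) refl }

  length-sigma : ∀ as {d} → (∀ {a} → a ∈ as → length (f a) ≡ d) → length (sigma as f) ≡ length as * d
  length-sigma []       _  = refl
  length-sigma (a ∷ as) eq = trans (List.length-++ (map (a ,_) (f a)))
    (cong₂ _+_ (trans (List.length-map _ (f a)) (eq (here refl))) (length-sigma as (eq ∘ there)))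

length-sigma-≥ : ∀ {A B : Set} {f : A → List B} as {d} → (∀ {a} → a ∈ as → d ≤ length (f a)) →
                 length as * d ≤ length (sigma as f)
length-sigma-≥         []       _  = z≤n
length-sigma-≥ {f = f} (a ∷ as) le = ≤-trans
  (+-mono-≤ (≤-trans (le (here refl)) (≤-reflexive (sym (List.length-map _ (f a)))))
    (length-sigma-≥ as (le ∘ there)))
  (≤-reflexive (sym (List.length-++ (map (a ,_) (f a)))))

choices : ∀ {A : Set} {k} → Vec (List A) k → List (Vec A k)
choices []        = [] ∷ []
choices (l ∷ ls) = map (uncurry _∷_) (sigma l (λ _ → choices ls))

module _ {A : Set} where

  ∈-choices⁺ : ∀ {k} (ls : Vec (List A) k) {v} → (∀ i → lookup v i ∈ lookup ls i) → v ∈ choices ls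
  ∈-choices⁺ []       {[]}    _ = here refl
  ∈-choices⁺ (l ∷ ls) {x ∷ v} p =
    ∈-map⁺ (uncurry _∷_) (∈-sigma⁺ (p zero) (∈-choices⁺ ls (p ∘ suc)))

  ∈-choices⁻ : ∀ {k} (ls : Vec (List A) k) {v} → v ∈ choices ls → ∀ i → lookup v i ∈ lookup ls i
  ∈-choices⁻ (l ∷ ls) v∈ i with (x , v) , xv∈ , refl ← ∈-map⁻ (uncurry _∷_) v∈
    with ∈-sigma⁻ l xv∈ | i
  ... | x∈ , _  | zero  = x∈
  ... | _  , v∈ | suc i = ∈-choices⁻ ls v∈ i

  choices-unique : ∀ {k} (ls : Vec (List A) k) → (∀ i → Unique (lookup ls i)) → Unique (choices ls)
  choices-unique []       _ = [] ∷ []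
  choices-unique (l ∷ ls) u = Unique.map⁺ (λ { refl → refl })
    (sigma-unique (u zero) (λ _ → choices-unique ls (u ∘ suc)))

  length-choices : ∀ {k d} (ls : Vec (List A) k) → (∀ i → length (lookup ls i) ≡ d) →
                   length (choices ls) ≡ d ^ k
  length-choices         []       _  = refl
  length-choices {d = d} (l ∷ ls) eq = trans (List.length-map _ (sigma l _))
    (trans (length-sigma l (λ _ → length-choices ls (eq ∘ suc))) (cong (_* _) (eq zero)))

-- Arithmetic

[m*n]^k≡m^k*n^k : ∀ m n k → (m * n) ^ k ≡ m ^ k * n ^ k
[m*n]^k≡m^k*n^k m n zero    = refl
[m*n]^k≡m^k*n^k m n (suc k) = trans (cong (m * n *_) ([m*n]^k≡m^k*n^k m n k))
  ([m*n]*[o*p]≡[m*o]*[n*p] m n (m ^ k) (n ^ k))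

m≤m^k : ∀ m k → .⦃ NonZero m ⦄ → .⦃ NonZero k ⦄ → m ≤ m ^ k
m≤m^k m k = subst (_≤ m ^ k) (^-identityʳ m) (^-monoʳ-≤ m (>-nonZero⁻¹ k))

-- Dividing `x` instead of `suc x` makes the lower bound strict, as the density hypothesis of
-- `sparse-edges` demands.
quotient : ∀ m x → .⦃ NonZero m ⦄ → ∃[ q ] (m * q < suc x × suc x ≤ m * suc q)
quotient m x = x DivMod./ m ,
  s≤s (≤-trans (≤-reflexive (*-comm m _)) (DivMod.m/n*n≤m x m)) ,
  (begin
    suc x                                          ≡⟨ cong suc (DivMod.m≡m%n+[m/n]*n x m) ⟩
    suc (x DivMod.% m) + (x DivMod./ m) * m        ≤⟨ +-monoˡ-≤ _ (DivMod.m%n<n x m) ⟩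
    suc (x DivMod./ m) * m                         ≡⟨ *-comm _ m ⟩
    m * suc (x DivMod./ m)                         ∎)
  where open ≤-Reasoning

-- The left-hand side is twice the bound on the number of bad walks in
-- SpiderFree.Walks.few-bad; the value of d is chosen for this inequality.
bad-walks-half : ∀ s′ q N c K T → let s = suc s′ ; d = 2 * s * suc s * q in
  2 * c + K + 1 + 2 * s′ ≤ q →
  2 * (s * (N * c * (d * T)) + s * (N * (T *
    ((c + (s′ * 1 + (s′ * q + K))) * d + d * (1 + (s′ * 1 + q))))))
  ≤ N * (d * (d * T))
bad-walks-half s′ q N c K T A≤q = begin
  2 * (s * (N * c * (d * T)) + s * (N * (T *
    ((c + (s′ * 1 + (s′ * q + K))) * d + d * (1 + (s′ * 1 + q))))))
    ≡⟨ collect s′ q N c K T d ⟩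
  N * (d * (2 * s * (2 * c + K + 1 + 2 * s′ + s * q) * T))
    ≤⟨ *-monoʳ-≤ N (*-monoʳ-≤ d (*-monoˡ-≤ T (*-monoʳ-≤ (2 * s) (+-monoˡ-≤ (s * q) A≤q)))) ⟩
  N * (d * (2 * s * (q + s * q) * T))
    ≡⟨ cong (λ e → N * (d * (e * T))) (sym (*-assoc (2 * s) (suc s) q)) ⟩
  N * (d * (d * T)) ∎
  where
  open ≤-Reasoning
  s d : ℕ
  s = suc s′
  d = 2 * s * suc s * q
  collect : ∀ s′ q N c K T d →
    2 * (suc s′ * (N * c * (d * T)) + suc s′ * (N * (T *
      ((c + (s′ * 1 + (s′ * q + K))) * d + d * (1 + (s′ * 1 + q))))))
    ≡ N * (d * (2 * suc s′ * (2 * c + K + 1 + 2 * s′ + suc s′ * q) * T))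
  collect = solve-∀

-- Applied with `x` the number of walks and `y`, `z` the bounds for bad and good ones: if at most
-- half are bad, the good ones account for the other half.
x≤y+z∧2y≤x⇒x≤2z : ∀ {x y z} → x ≤ y + z → 2 * y ≤ x → x ≤ 2 * z
x≤y+z∧2y≤x⇒x≤2z {x} {y} {z} x≤ 2y≤ = +-cancelˡ-≤ x _ _ (begin
  x + x                ≤⟨ +-mono-≤ x≤ x≤ ⟩
  (y + z) + (y + z)    ≡⟨ regroup y z ⟩
  2 * y + 2 * z        ≤⟨ +-monoˡ-≤ (2 * z) 2y≤ ⟩
  x + 2 * z            ∎)
  where
  open ≤-Reasoning
  regroup : ∀ y z → (y + z) + (y + z) ≡ 2 * y + 2 * z
  regroup = solve-∀

-- The cancellation of powers is done in this contrapositive form, so that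
-- no roots are needed.
power-bound : ∀ {x y n P} h → x ≤ y * n → y ^ h ≤ P → x ^ (h + h) ≤ P * P * (n ^ h * n ^ h)
power-bound {x} {y} {n} {P} h x≤yn y^h≤P = begin
  x ^ (h + h)                               ≡⟨ ^-distribˡ-+-* x h h ⟩
  x ^ h * x ^ h                             ≤⟨ *-mono-≤ x^h≤ x^h≤ ⟩
  (P * n ^ h) * (P * n ^ h)                 ≡⟨ [m*n]*[o*p]≡[m*o]*[n*p] P (n ^ h) P (n ^ h) ⟩
  P * P * (n ^ h * n ^ h)                   ∎
  where
  open ≤-Reasoning
  x^h≤ : x ^ h ≤ P * n ^ h
  x^h≤ = begin
    x ^ h          ≤⟨ ^-monoˡ-≤ h x≤yn ⟩
    (y * n) ^ h    ≡⟨ [m*n]^k≡m^k*n^k y n h ⟩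
    y ^ h * n ^ h  ≤⟨ *-monoˡ-≤ (n ^ h) y^h≤P ⟩
    P * n ^ h      ∎

-- Used to strip the factor `2 * Q` and then 2 from the bases in `edges-bound`.
cancel-power : ∀ m x y h z → (m * x) ^ h * z < (m * y) ^ h → x ^ h * z < y ^ h
cancel-power m x y h z lt = ≰⇒> λ le → <⇒≱ lt (begin
  (m * y) ^ h         ≡⟨ [m*n]^k≡m^k*n^k m y h ⟩
  m ^ h * y ^ h       ≤⟨ *-monoʳ-≤ (m ^ h) le ⟩
  m ^ h * (x ^ h * z) ≡⟨ sym (*-assoc (m ^ h) (x ^ h) z) ⟩
  m ^ h * x ^ h * z   ≡⟨ cong (_* z) (sym ([m*n]^k≡m^k*n^k m x h)) ⟩
  (m * x) ^ h * z     ∎)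
  where open ≤-Reasoning

-- Spiders

Distinct : ∀ {A : Set} {k} → Vec A k → Set
Distinct v = ∀ i j → lookup v i ≡ lookup v j → i ≡ j

distinct-∷ : ∀ {A : Set} {k} {x : A} {v : Vec A k} →
             (∀ i → lookup v i ≢ x) → Distinct v → Distinct (x ∷ v)
distinct-∷ x∉ d zero    zero    eq = refl
distinct-∷ x∉ d zero    (suc j) eq with () ← x∉ j (sym eq)
distinct-∷ x∉ d (suc i) zero    eq with () ← x∉ i eq
distinct-∷ x∉ d (suc i) (suc j) eq = cong suc (d i j eq)

lookup-removeAt : ∀ {A : Set} {k} (v : Vec A (suc k)) i j →
                  lookup (removeAt v i) j ≡ lookup v (punchIn i j)
lookup-removeAt v i j = trans (cong (lookup (removeAt v i)) (sym (Fin.punchOut-punchIn i)))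
  (Vec.removeAt-punchOut v (Fin.punchInᵢ≢i i j ∘ sym))

lookup∈toList : ∀ {A : Set} {k} (v : Vec A k) i → lookup v i ∈ Vec.toList v
lookup∈toList v i = Vec.∈-toList⁺ (Vec.∈-lookup i v)

-- Greedy choice: each representative joins the forbidden list `us` while one list disappears, so
-- `length us + k` stays the same and remains a lower bound for every list.
distinct-representatives : ∀ {A : Set} → DecidableEquality A →
  ∀ {k} (ls : Vec (List A) k) (us : List A) →
  (∀ i → Unique (lookup ls i)) → (∀ i → length us + k ≤ length (lookup ls i)) →
  ∃[ v ] (Distinct v × (∀ i → lookup v i ∈ lookup ls i) × (∀ i → lookup v i ∉ us))
distinct-representatives _≟_ [] us _ _ = [] , (λ ()) , (λ ()) , (λ ())
distinct-representatives _≟_ {suc k} (l ∷ ls) us u long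
  with x , x∈ , x∉ ← survivor (λ y → any? (y ≟_) us) (u zero) (cover-⊆ proj₂ (cover-∈ us))
                       (≤-trans (m<m+n (length us) (s≤s z≤n)) (long zero))
  with v , dist , v∈ , v∉ ← distinct-representatives _≟_ ls (x ∷ us) (u ∘ suc)
                              (λ i → ≤-trans (≤-reflexive (sym (+-suc (length us) k))) (long (suc i)))
  = x ∷ v , distinct-∷ (λ i eq → v∉ i (here eq)) dist
  , (λ { zero → x∈ ; (suc i) → v∈ i })
  , (λ { zero → x∉ ; (suc i) → v∉ i ∘ there })

module Spiders {n : ℕ} (G : Graph (Fin n)) where
  open Graph G

  V : Set
  V = Fin n

  -- The ends may coincide with each other or with other vertices of the spider; `Distinct xs`, and
  -- `Avoids` for a list containing the ends, rule this out where a copy is built.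
  Spider : ∀ {s} → V → Vec V s → Vec V s → Set
  Spider z ms xs = (∀ i → z ~ lookup ms i) × (∀ i → lookup ms i ~ lookup xs i) × Distinct ms

  Avoids : ∀ {s} → List V → V → Vec V s → Set
  Avoids us z ms = z ∉ us × (∀ i → lookup ms i ∉ us)

  module _ {s} (xs : Vec V s) where

    -- The index lists the vertices to be avoided. It starts with the ends, and each spider adds its
    -- own vertices for those that follow, which encodes pairwise disjointness.
    data DisjointSpiders : ℕ → List V → Set where
      []  : ∀ {us} → DisjointSpiders 0 us
      add : ∀ {k us z ms} → Spider z ms xs → Avoids us z ms →
            DisjointSpiders k (z ∷ Vec.toList ms ++ us) → DisjointSpiders (suc k) us

    center : ∀ {k us} → DisjointSpiders k us → Fin k → V
    center (add {z = z} _ _ F) zero    = z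
    center (add _ _ F)         (suc j) = center F j

    mid : ∀ {k us} → DisjointSpiders k us → Fin k → Fin s → V
    mid (add {ms = ms} _ _ F) zero    = lookup ms
    mid (add _ _ F)           (suc j) = mid F j

    center~mid : ∀ {k us} (F : DisjointSpiders k us) j i → center F j ~ mid F j i
    center~mid (add (z~m , _) _ F) zero    = z~m
    center~mid (add _ _ F)         (suc j) = center~mid F j

    mid~leaf : ∀ {k us} (F : DisjointSpiders k us) j i → mid F j i ~ lookup xs i
    mid~leaf (add (_ , m~x , _) _ F) zero    = m~x
    mid~leaf (add _ _ F)             (suc j) = mid~leaf F j

    center∉ : ∀ {k us} (F : DisjointSpiders k us) j → center F j ∉ us
    center∉ (add _ av F)           zero    = proj₁ av
    center∉ (add {ms = ms} _ _ F) (suc j) = center∉ F j ∘ there ∘ ∈-++⁺ʳ (Vec.toList ms)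

    mid∉ : ∀ {k us} (F : DisjointSpiders k us) j i → mid F j i ∉ us
    mid∉ (add _ av F)           zero    i = proj₂ av i
    mid∉ (add {ms = ms} _ _ F) (suc j) i = mid∉ F j i ∘ there ∘ ∈-++⁺ʳ (Vec.toList ms)

    center-injective : ∀ {k us} (F : DisjointSpiders k us) {j j′} → center F j ≡ center F j′ → j ≡ j′
    center-injective (add _ _ F) {zero}  {zero}   _  = refl
    center-injective (add _ _ F) {zero}  {suc j′} eq with () ← center∉ F j′ (here (sym eq))
    center-injective (add _ _ F) {suc j} {zero}   eq with () ← center∉ F j (here eq)
    center-injective (add _ _ F) {suc j} {suc j′} eq = cong suc (center-injective F eq)

    mid-injective : ∀ {k us} (F : DisjointSpiders k us) {j j′ i i′} → mid F j i ≡ mid F j′ i′ →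
                    (i , j) ≡ (i′ , j′)
    mid-injective (add (_ , _ , d) _ F) {zero} {zero} eq = cong (_, zero) (d _ _ eq)
    mid-injective (add {ms = ms} _ _ F) {zero} {suc j′} {i} {i′} eq
      with () ← mid∉ F j′ i′ (there (∈-++⁺ˡ (subst (_∈ _) eq (lookup∈toList ms i))))
    mid-injective (add {ms = ms} _ _ F) {suc j} {zero} {i} {i′} eq
      with () ← mid∉ F j i (there (∈-++⁺ˡ (subst (_∈ _) (sym eq) (lookup∈toList ms i′))))
    mid-injective (add _ _ F) {suc j} {suc j′} eq with refl ← mid-injective F eq = refl

    center≢mid : ∀ {k us} (F : DisjointSpiders k us) j j′ i → center F j ≢ mid F j′ i
    center≢mid (add (z~m , _) _ F)   zero    zero     i eq = ~-irr eq (z~m i)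
    center≢mid (add _ _ F)           zero    (suc j′) i eq = mid∉ F j′ i (here (sym eq))
    center≢mid (add {ms = ms} _ _ F) (suc j) zero     i eq =
      center∉ F j (there (∈-++⁺ˡ (subst (_∈ _) (sym eq) (lookup∈toList ms i))))
    center≢mid (add _ _ F)           (suc j) (suc j′) i eq = center≢mid F j j′ i eq

    -- The ends form the side of size `s`, the centres the side of size `t`, and the midpoints
    -- subdivide the edges.
    disjointSpiders⇒copy : ∀ {t} → Distinct xs → DisjointSpiders t (Vec.toList xs) →
                           Copy (FiniteGraph.graph (K′ s t)) G
    disjointSpiders⇒copy {t} dist F = record { embed = f ; injective = inj ; preserves = pres }
      where
      f : SubdivisionVertex s t → V
      f (inj₁ (inj₁ i))   = lookup xs i
      f (inj₁ (inj₂ j))   = center F j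
      f (inj₂ (i , j))    = mid F j i

      leaf∈ : ∀ {i u} → lookup xs i ≡ u → u ∈ Vec.toList xs
      leaf∈ {i} refl = lookup∈toList xs i

      inj : ∀ {u v} → f u ≡ f v → u ≡ v
      inj {inj₁ (inj₁ i)} {inj₁ (inj₁ i′)} eq = cong (inj₁ ∘ inj₁) (dist i i′ eq)
      inj {inj₁ (inj₁ i)} {inj₁ (inj₂ j)}  eq with () ← center∉ F j (leaf∈ eq)
      inj {inj₁ (inj₁ i)} {inj₂ (_ , j)}   eq with () ← mid∉ F j _ (leaf∈ eq)
      inj {inj₁ (inj₂ j)} {inj₁ (inj₁ i)}  eq with () ← center∉ F j (leaf∈ (sym eq))
      inj {inj₁ (inj₂ j)} {inj₁ (inj₂ j′)} eq = cong (inj₁ ∘ inj₂) (center-injective F eq)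
      inj {inj₁ (inj₂ j)} {inj₂ (i , j′)}  eq with () ← center≢mid F j j′ i eq
      inj {inj₂ (_ , j)}  {inj₁ (inj₁ i)}  eq with () ← mid∉ F j _ (leaf∈ (sym eq))
      inj {inj₂ (i , j)}  {inj₁ (inj₂ j′)} eq with () ← center≢mid F j′ j i (sym eq)
      inj {inj₂ (i , j)}  {inj₂ (i′ , j′)} eq = cong inj₂ (mid-injective F eq)

      pres : ∀ {u v} → SubdivisionAdj u v → f u ~ f v
      pres (to-mid (left {i} {j}))    = ~-sym (mid~leaf F j i)
      pres (to-mid (right {i} {j}))   = center~mid F j i
      pres (from-mid (left {i} {j}))  = mid~leaf F j i
      pres (from-mid (right {i} {j})) = ~-sym (center~mid F j i)

    spiders⇒copy : ∀ t → Distinct xs →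
      (∀ us → length us ≤ s + t * suc s → ∃[ z ] ∃[ ms ] (Spider z ms xs × Avoids us z ms)) →
      Copy (FiniteGraph.graph (K′ s t)) G
    spiders⇒copy t dist next = disjointSpiders⇒copy dist
      (build t (Vec.toList xs) (≤-reflexive (cong (_+ t * suc s) (Vec.length-toList xs))))
      where
      -- Each of the `k` spiders still to be placed uses `suc s` new vertices, so this sum is
      -- invariant and bounds `length us` throughout.
      build : ∀ k us → length us + k * suc s ≤ s + t * suc s → DisjointSpiders k us
      build zero    us le = []
      build (suc k) us le with z , ms , sp , av ← next us (≤-trans (m≤m+n _ _) le) =
        add sp av (build k (z ∷ Vec.toList ms ++ us) (≤-trans (≤-reflexive eq) le))
        where
        eq : length (z ∷ Vec.toList ms ++ us) + k * suc s ≡ length us + (suc s + k * suc s)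
        eq = begin
          suc (length (Vec.toList ms ++ us) + k * suc s)
            ≡⟨ cong (λ l → suc (l + k * suc s)) (List.length-++ (Vec.toList ms)) ⟩
          suc (length (Vec.toList ms) + length us + k * suc s)
            ≡⟨ cong (λ l → suc (l + length us + k * suc s)) (Vec.length-toList ms) ⟩
          suc s + length us + k * suc s ≡⟨ cong (_+ k * suc s) (+-comm (suc s) (length us)) ⟩
          length us + suc s + k * suc s ≡⟨ +-assoc (length us) (suc s) (k * suc s) ⟩
          length us + (suc s + k * suc s) ∎
          where open ≡-Reasoning

  commonNeighbours : V → V → List V
  commonNeighbours u w = filter (λ m → (u ~? m) ×-dec (m ~? w)) (allFin n)

  ∈-commonNeighbours⁺ : ∀ {u w m} → u ~ m → m ~ w → m ∈ commonNeighbours u w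
  ∈-commonNeighbours⁺ u~m m~w = ∈-filter⁺ _ (∈-allFin _) (u~m , m~w)

  ∈-commonNeighbours⁻ : ∀ {u w m} → m ∈ commonNeighbours u w → u ~ m × m ~ w
  ∈-commonNeighbours⁻ {u} {w} m∈ = proj₂ (∈-filter⁻ (λ m → (u ~? m) ×-dec (m ~? w)) {xs = allFin n} m∈)

  commonNeighbours-unique : ∀ u w → Unique (commonNeighbours u w)
  commonNeighbours-unique u w = Unique.filter⁺ _ (Unique.allFin⁺ n)

  -- The midpoints are distinct representatives of the common neighbourhoods of `z` with each end.
  spider-between : ∀ {s} z (xs : Vec V s) us →
    (∀ i → length us + s ≤ length (commonNeighbours z (lookup xs i))) →
    ∃[ ms ] (Spider z ms xs × ∀ i → lookup ms i ∉ us)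
  spider-between z xs us heavy
    with ms , dist , ms∈ , ms∉ ← distinct-representatives Fin._≟_ (Vec.map (commonNeighbours z) xs) us
           (λ i → subst Unique (sym (Vec.lookup-map i _ xs)) (commonNeighbours-unique z _))
           (λ i → ≤-trans (heavy i) (≤-reflexive (cong length (sym (Vec.lookup-map i _ xs)))))
    = ms , ((λ i → proj₁ (adj i)) , (λ i → proj₂ (adj i)) , dist) , ms∉
    where
    adj : ∀ i → z ~ lookup ms i × lookup ms i ~ lookup xs i
    adj i = ∈-commonNeighbours⁻ (subst (lookup ms i ∈_) (Vec.lookup-map i _ xs) (ms∈ i))

-- Subgraphs of large minimum degree

module _ {n : ℕ} (G : Graph (Fin n)) where
  open Graph G

  neighboursIn : List (Fin n) → Fin n → List (Fin n)
  neighboursIn vs v = filter (v ~?_) vs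

  -- Ordered pairs, so an edge within `vs` counts twice and deleting a vertex costs twice its
  -- degree.
  adjacentPairs : List (Fin n) → List (Fin n × Fin n)
  adjacentPairs vs = filter (uncurry _~?_) (cartesianProduct vs vs)

  edges≤adjacentPairs : edges G ≤ length (adjacentPairs (allFin n))
  edges≤adjacentPairs = unique-⊆
    (Unique.filter⁺ _ (Unique.cartesianProduct⁺ (Unique.allFin⁺ n) (Unique.allFin⁺ n)))
    (λ e∈ → let e∈′ , _ , u~w = ∈-filter⁻ (λ (i , j) → (i Fin.<? j) ×-dec (i ~? j))
                                  {xs = cartesianProduct (allFin n) (allFin n)} e∈
            in ∈-filter⁺ (uncurry _~?_) e∈′ u~w)

  adjacentPairs-delete : ∀ v {vs} → Unique vs → length (adjacentPairs vs) ≤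
    length (adjacentPairs (filter (λ w → ¬? (w Fin.≟ v)) vs)) +
    (length (neighboursIn vs v) + length (neighboursIn vs v))
  adjacentPairs-delete v {vs} u = unique-bound {P = λ (x , y) → x ∈ vs × y ∈ vs × x ~ y}
    (Unique.filter⁺ _ (Unique.cartesianProduct⁺ u u))
    (λ p∈ → let p∈′ , x~y = ∈-filter⁻ (uncurry _~?_) {xs = cartesianProduct vs vs} p∈
                x∈ , y∈ = ∈-cartesianProduct⁻ vs vs p∈′
            in x∈ , y∈ , x~y)
    (cover-⊆ split (cover-∪ (cover-∈ (adjacentPairs vs∖v)) (cover-∪
      (cover-image (v ,_) (λ { {_ , y} (refl , y∈ , v~y) → y , refl , ∈-filter⁺ (v ~?_) y∈ v~y })
        (cover-∈ (neighboursIn vs v)))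
      (cover-image (_, v) (λ { {x , _} (refl , x∈ , x~v) → x , refl , ∈-filter⁺ (v ~?_) x∈ (~-sym x~v) })
        (cover-∈ (neighboursIn vs v))))))
    where
    vs∖v : List (Fin n)
    vs∖v = filter (λ w → ¬? (w Fin.≟ v)) vs
    split : ∀ {p} → proj₁ p ∈ vs × proj₂ p ∈ vs × proj₁ p ~ proj₂ p →
      p ∈ adjacentPairs vs∖v ⊎ (proj₁ p ≡ v × proj₂ p ∈ vs × v ~ proj₂ p) ⊎
      (proj₂ p ≡ v × proj₁ p ∈ vs × proj₁ p ~ v)
    split {x , y} (x∈ , y∈ , x~y) with x Fin.≟ v | y Fin.≟ v
    ... | yes refl | _        = inj₂ (inj₁ (refl , y∈ , x~y))
    ... | no _     | yes refl = inj₂ (inj₂ (refl , x∈ , x~y))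
    ... | no x≢v   | no y≢v   = inj₁ (∈-filter⁺ (uncurry _~?_) (∈-cartesianProduct⁺
            (∈-filter⁺ (λ w → ¬? (w Fin.≟ v)) x∈ x≢v) (∈-filter⁺ (λ w → ¬? (w Fin.≟ v)) y∈ y≢v)) x~y)

  -- Vertices of degree below `d` are deleted one by one. Each deletion loses at most `2 * d`
  -- ordered pairs, so the density hypothesis persists; it fails for the empty list, hence the
  -- process stops earlier. The bound `k` on the length makes the recursion structural.
  min-degree-sublist : ∀ d k vs → length vs ≤ k → Unique vs →
    2 * d * length vs < length (adjacentPairs vs) →
    ∃[ ws ] (Unique ws × 0 < length ws × (∀ {w} → w ∈ ws → d ≤ length (neighboursIn ws w)))
  min-degree-sublist d zero    []      _  _ lt with () ← ≤-<-trans z≤n lt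
  min-degree-sublist d (suc k) []      _  _ lt with () ← ≤-<-trans z≤n lt
  min-degree-sublist d (suc k) vs@(_ ∷ _) le u lt
    with All.all? (λ v → d ≤? length (neighboursIn vs v)) vs
  ... | yes all = vs , u , s≤s z≤n , λ w∈ → All.lookup {P = λ v → d ≤ length (neighboursIn vs v)} all w∈
  ... | no ¬all with v , v∈ , deg< ← find (All.¬All⇒Any¬ (λ v → d ≤? length (neighboursIn vs v)) vs ¬all) =
    min-degree-sublist d k vs∖v (≤-trans (≤-pred shorter) (≤-pred le))
      (Unique.filter⁺ (λ w → ¬? (w Fin.≟ v)) u) (+-cancelʳ-< (d + d) _ _ dense)
    where
    vs∖v : List (Fin n)
    vs∖v = filter (λ w → ¬? (w Fin.≟ v)) vs
    shorter : length vs∖v < length vs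
    shorter = List.filter-notAll (λ w → ¬? (w Fin.≟ v)) vs (lose v∈ (λ ¬v → ¬v refl))
    deg≤ : length (neighboursIn vs v) ≤ d
    deg≤ = <⇒≤ (≰⇒> deg<)
    identity : ∀ d l → 2 * d * l + (d + d) ≡ 2 * d * suc l
    identity = solve-∀
    dense : 2 * d * length vs∖v + (d + d) < length (adjacentPairs vs∖v) + (d + d)
    dense = begin-strict
      2 * d * length vs∖v + (d + d)                   ≡⟨ identity d (length vs∖v) ⟩
      2 * d * suc (length vs∖v)                       ≤⟨ *-monoʳ-≤ (2 * d) shorter ⟩
      2 * d * length vs                               <⟨ lt ⟩
      length (adjacentPairs vs)                       ≤⟨ adjacentPairs-delete v u ⟩
      length (adjacentPairs vs∖v) + (length (neighboursIn vs v) + length (neighboursIn vs v))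
                                                      ≤⟨ +-monoʳ-≤ (length (adjacentPairs vs∖v)) (+-mono-≤ deg≤ deg≤) ⟩
      length (adjacentPairs vs∖v) + (d + d)           ∎
      where open ≤-Reasoning

-- Graphs without a subdivided complete bipartite graph

nonempty : ∀ {A : Set} (xs : List A) → 0 < length xs → ∃[ x ] x ∈ xs
nonempty (x ∷ _) _ = x , here refl

-- `K` bounds the vertices in use during a greedy embedding. A pair of codegree `L` has at least
-- `suc s′` common neighbours outside any `K` vertices. `R` exceeds the number of brooms that can
-- meet `K` given vertices.
module SpiderFree {n : ℕ} (G : Graph (Fin n)) (s′ t K L R : ℕ)
  (K-large : suc s′ + t * suc (suc s′) ≤ K)
  (L-large : K + suc s′ ≤ L)
  (R-large : K * (L ^ s′ + L * L ^ s′) < R)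
  (free : G FreeOf FiniteGraph.graph (K′ (suc s′) t)) where

  open Graph G
  open Spiders G

  s : ℕ
  s = suc s′

  -- The greedy embedding in contrapositive form; every bound on heavy pairs, rich midpoints or good
  -- spiders comes from it.
  no-spiders : ∀ {xs : Vec V s} → Distinct xs →
    ¬ (∀ us → length us ≤ K → ∃[ z ] ∃[ ms ] (Spider z ms xs × Avoids us z ms))
  no-spiders {xs} dist next = free (spiders⇒copy xs t dist λ us le → next us (≤-trans le K-large))

  -- Pairs of large codegree.

  Heavy : V → V → Set
  Heavy u w = L ≤ length (commonNeighbours u w)

  heavy? : ∀ u w → Dec (Heavy u w)
  heavy? u w = L ≤? length (commonNeighbours u w)

  cover-light : ∀ u w → Cover (λ m → ¬ Heavy u w × m ∈ commonNeighbours u w) L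
  cover-light u w = cover-guard (¬? (heavy? u w)) λ ¬h → cover-weaken (<⇒≤ (≰⇒> ¬h)) (cover-∈ _)

  no-heavy-leaves : ∀ (xs : Vec V s) → Distinct xs → ∀ {us} → Unique us →
    (∀ {u} → u ∈ us → ∀ i → Heavy u (lookup xs i)) → length us ≤ K
  no-heavy-leaves xs dist {us} u heavy = ≮⇒≥ λ K< → no-spiders {xs} dist λ vs vs≤ →
    let z , z∈ , z∉ = survivor (λ y → any? (y Fin.≟_) vs) u (cover-⊆ proj₂ (cover-∈ vs))
                            (≤-<-trans vs≤ K<)
        ms , sp , ms∉ = spider-between z xs vs
          (λ i → ≤-trans (≤-trans (+-monoˡ-≤ s vs≤) L-large) (heavy z∈ i))
    in z , ms , sp , z∉ , ms∉

  module _ {Q q} {ws : List V} (ws-unique : Unique ws) (2s≤q : 2 * s ≤ q) (ws≤ : length ws ≤ Q * q) where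

    private
      s≤q∸s : s ≤ q ∸ s
      s≤q∸s = m+n≤o⇒m≤o∸n s (≤-trans (≤-reflexive (cong (λ m → s + m) (sym (+-identityʳ s)))) 2s≤q)

      q≤2[q∸s] : q ≤ 2 * (q ∸ s)
      q≤2[q∸s] = begin
        q                     ≤⟨ m≤n+m∸n q s ⟩
        s + (q ∸ s)           ≤⟨ +-monoˡ-≤ (q ∸ s) s≤q∸s ⟩
        (q ∸ s) + (q ∸ s)     ≡⟨ cong (λ m → (q ∸ s) + m) (sym (+-identityʳ _)) ⟩
        2 * (q ∸ s)           ∎
        where open ≤-Reasoning

      -- The size condition for the pigeonhole below. Discarding at most `s` used leaves keeps
      -- `q ∸ s`, at least half of `q`, partners per vertex; compared with `Q * q` possible leaves
      -- this costs the factor `2 * Q`.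
      ws-small : ∀ c {l} → 2 * Q * c < l → length ws * c < l * (q ∸ s)
      ws-small c {l} lt = begin-strict
        length ws * c             ≤⟨ *-monoˡ-≤ c ws≤ ⟩
        Q * q * c                 ≤⟨ *-monoˡ-≤ c (*-monoʳ-≤ Q q≤2[q∸s]) ⟩
        Q * (2 * (q ∸ s)) * c     ≡⟨ rearrange Q (q ∸ s) c ⟩
        2 * Q * c * (q ∸ s)       <⟨ *-monoˡ-< (q ∸ s) ⦃ >-nonZero (≤-trans (s≤s z≤n) s≤q∸s) ⦄ lt ⟩
        l * (q ∸ s)               ∎
        where
        open ≤-Reasoning
        rearrange : ∀ Q r c → Q * (2 * r) * c ≡ 2 * Q * c * r
        rearrange = solve-∀

    -- Leaves common to many of the vertices are found one at a time, each
    -- costing a factor 2Q in the number of vertices.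
    few-popular : ∀ k {j} (xs : Vec V j) → k + j ≡ s → Distinct xs → ∀ {us} → Unique us →
      (∀ {u} → u ∈ us → ∀ i → Heavy u (lookup xs i)) →
      (∀ {u} → u ∈ us → q ≤ length (filter (heavy? u) ws)) →
      length us ≤ (2 * Q) ^ k * K
    few-popular zero xs refl dist u heavy _ =
      ≤-trans (no-heavy-leaves xs dist u heavy) (≤-reflexive (sym (+-identityʳ K)))
    few-popular (suc k) {j} xs k+j dist {us} u heavy popular = ≮⇒≥ λ lt →
      -- Among the pairs of a vertex `u` and a new leaf heavy with it, some leaf `w` occurs more
      -- than `(2 * Q) ^ k * K` times; the vertices heavy with `w` then contradict the bound for
      -- `w ∷ xs`.
      absurd (pigeonhole Fin._≟_ proj₂ pairs-unique
      (λ p∈ → proj₁ (heavyIn (pair∈ p∈)))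
      (<-≤-trans (ws-small ((2 * Q) ^ k * K) (subst (_< length us) (*-assoc (2 * Q) ((2 * Q) ^ k) K) lt))
        (length-sigma-≥ us many-new)))
      where
      used? : Decidable (_∈ Vec.toList xs)
      used? w = any? (w Fin.≟_) (Vec.toList xs)
      new : V → List V
      new u = filter (λ w → ¬? (used? w)) (filter (heavy? u) ws)
      pairs : List (V × V)
      pairs = sigma us new
      pairs-unique : Unique pairs
      pairs-unique = sigma-unique u (λ u → Unique.filter⁺ _ (Unique.filter⁺ (heavy? u) ws-unique))
      pair∈ : ∀ {p} → p ∈ pairs → proj₂ p ∈ filter (heavy? (proj₁ p)) ws
      pair∈ {p} p∈ = proj₁ (∈-filter⁻ (λ w → ¬? (used? w)) (proj₂ (∈-sigma⁻ us p∈)))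
      heavyIn : ∀ {u w} → w ∈ filter (heavy? u) ws → w ∈ ws × Heavy u w
      heavyIn {u} = ∈-filter⁻ (heavy? u)
      many-new : ∀ {u} → u ∈ us → q ∸ s ≤ length (new u)
      many-new {u} u∈ = m≤n+o⇒m∸n≤o q s (≤-trans (popular u∈)
        (survivors used? (Unique.filter⁺ (heavy? u) ws-unique)
          (cover-weaken (≤-trans (≤-reflexive (Vec.length-toList xs))
                          (≤-trans (m≤n+m j (suc k)) (≤-reflexive k+j)))
            (cover-⊆ proj₂ (cover-∈ (Vec.toList xs))))))
      absurd : ¬ (∃[ w ] ((2 * Q) ^ k * K < length (filter (λ p → proj₂ p Fin.≟ w) pairs)))
      absurd (w , many)
        -- A single pair over `w` is extracted to certify that `w` is not already in `xs`.
        with (u₀ , _) , p∈ ← nonempty (filter (λ p → proj₂ p Fin.≟ w) pairs) (≤-<-trans z≤n many)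
        with p∈pairs , refl ← ∈-filter⁻ (λ p → proj₂ p Fin.≟ w) {xs = pairs} p∈
        = <⇒≱ (<-≤-trans many (unique-bound (Unique.filter⁺ _ pairs-unique) (∈-filter⁻ _) pairs-at))
            (few-popular k (w ∷ xs) (trans (+-suc k j) k+j) (distinct-∷ (λ i → new≢ i) dist)
              (Unique.filter⁺ _ u)
              (λ u∈ → λ { zero → proj₂ (u⁻ u∈) ; (suc i) → heavy (proj₁ (u⁻ u∈)) i })
              (popular ∘ proj₁ ∘ u⁻))
        where
        pairs-at : Cover (λ p → p ∈ pairs × proj₂ p ≡ w) (length (filter (λ u → heavy? u w) us))
        pairs-at = cover-image (_, w)
          (λ { {u , _} (p∈ , refl) → u , refl
             , ∈-filter⁺ (λ u → heavy? u w) (proj₁ (∈-sigma⁻ us p∈)) (proj₂ (heavyIn (pair∈ p∈))) })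
          (cover-∈ (filter (λ u → heavy? u w) us))
        u⁻ : ∀ {u} → u ∈ filter (λ u → heavy? u w) us → u ∈ us × Heavy u w
        u⁻ = ∈-filter⁻ (λ u → heavy? u w)
        new≢ : ∀ i → lookup xs i ≢ w
        new≢ i refl = proj₂ (∈-filter⁻ (λ w → ¬? (used? w)) {xs = filter (heavy? u₀) ws}
          (proj₂ (∈-sigma⁻ us p∈pairs))) (lookup∈toList xs i)

  -- A broom at m₀ is a spider with leg m₀ whose end is left open, and with
  -- the remaining ends prescribed.
  Broom : ∀ {k} → V → Vec V k → V × Vec V k → Set
  Broom m₀ xs (z , ms) = z ~ m₀ × (∀ i → z ~ lookup ms i) × (∀ i → lookup ms i ~ lookup xs i) ×
    Distinct (m₀ ∷ ms) × (∀ i → ¬ Heavy z (lookup xs i)) × (∀ i → ¬ Heavy m₀ (lookup ms i))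

  distinct? : ∀ {k} (v : Vec V k) → Dec (Distinct v)
  distinct? v = Fin.all? λ i → Fin.all? λ j → (lookup v i Fin.≟ lookup v j) →-dec (i Fin.≟ j)

  broom? : ∀ {k} m₀ (xs : Vec V k) → Decidable (Broom m₀ xs)
  broom? m₀ xs (z , ms) = (z ~? m₀) ×-dec Fin.all? (λ i → z ~? lookup ms i) ×-dec
    Fin.all? (λ i → lookup ms i ~? lookup xs i) ×-dec distinct? (m₀ ∷ ms) ×-dec
    Fin.all? (λ i → ¬? (heavy? z (lookup xs i))) ×-dec Fin.all? (λ i → ¬? (heavy? m₀ (lookup ms i)))

  brooms : ∀ {k} → V → Vec V k → List (V × Vec V k)
  brooms {k} m₀ xs = filter (broom? m₀ xs) (sigma (allFin n) (λ _ → choices (replicate k (allFin n))))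

  ∈-brooms⁺ : ∀ {k m₀} (xs : Vec V k) {b} → Broom m₀ xs b → b ∈ brooms m₀ xs
  ∈-brooms⁺ {k} {m₀} xs {z , ms} = ∈-filter⁺ (broom? m₀ xs) (∈-sigma⁺ (∈-allFin z)
    (∈-choices⁺ (replicate k (allFin n)) {ms}
      (λ i → subst (lookup ms i ∈_) (sym (Vec.lookup-replicate i (allFin n))) (∈-allFin _))))

  ∈-brooms⁻ : ∀ {k m₀} (xs : Vec V k) {b} → b ∈ brooms m₀ xs → Broom m₀ xs b
  ∈-brooms⁻ {k} {m₀} xs b∈ = proj₂ (∈-filter⁻ (broom? m₀ xs)
    {xs = sigma (allFin n) (λ _ → choices (replicate k (allFin n)))} b∈)

  brooms-unique : ∀ {k} m₀ (xs : Vec V k) → Unique (brooms m₀ xs)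
  brooms-unique {k} m₀ xs = Unique.filter⁺ (broom? m₀ xs) (sigma-unique (Unique.allFin⁺ n)
    (λ _ → choices-unique (replicate k (allFin n))
      (λ i → subst Unique (sym (Vec.lookup-replicate i _)) (Unique.allFin⁺ n))))

  Rich : V → Vec V s′ → Set
  Rich m₀ xs = R ≤ length (brooms m₀ xs)

  rich? : ∀ m₀ xs → Dec (Rich m₀ xs)
  rich? m₀ xs = R ≤? length (brooms m₀ xs)

  Touches : ∀ {k} → V × Vec V k → V → Set
  Touches (z , ms) u = z ≡ u ⊎ ∃[ i ] (lookup ms i ≡ u)

  touches? : ∀ {k} (b : V × Vec V k) us → Dec (Any (Touches b) us)
  touches? (z , ms) = any? (λ u → (z Fin.≟ u) ⊎-dec Fin.any? (λ i → lookup ms i Fin.≟ u))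

  ¬touches⇒avoids : ∀ {k z us} (ms : Vec V k) → ¬ Any (Touches (z , ms)) us → Avoids us z ms
  ¬touches⇒avoids ms ¬t = (λ z∈ → ¬t (lose z∈ (inj₁ refl))) , (λ i m∈ → ¬t (lose m∈ (inj₂ (i , refl))))

  -- If the centre is `u`, lightness towards the ends leaves at most `L` choices for each of the
  -- `s′` midpoints. If a midpoint is `u`, the centre is a common neighbour of the light pair `m₀`,
  -- `u`, which gives `L` centres and again `L ^ s′` midpoint tuples.
  few-touching-brooms : ∀ m₀ (xs : Vec V s′) us → length us ≤ K →
    Cover (λ b → b ∈ brooms m₀ xs × Any (Touches b) us) (K * (L ^ s′ + L * L ^ s′))
  few-touching-brooms m₀ xs us us≤ = cover-weaken (*-monoˡ-≤ _ us≤)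
    (cover-⊆ (λ (b∈ , t) → let u , u∈ , tu = find t in u , u∈ , ∈-brooms⁻ xs b∈ , tu)
      (cover-∃∈ us (λ {u} _ → touching u)))
    where
    Legs : V → Vec V s′ → Set
    Legs z ms = ∀ i → ¬ Heavy z (lookup xs i) × lookup ms i ∈ commonNeighbours z (lookup xs i)

    legs : ∀ z → Cover (Legs z) (L ^ s′)
    legs z = cover-Vec (λ i → cover-light z (lookup xs i))

    touching : ∀ u → Cover (λ b → Broom m₀ xs b × Touches b u) (L ^ s′ + L * L ^ s′)
    touching u = cover-⊆ {Q = λ (z , ms) → (z ∈ u ∷ [] × Legs z ms) ⊎
                                ((¬ Heavy m₀ u × z ∈ commonNeighbours m₀ u) × Legs z ms)}
      (λ { {z , ms} ((z~m₀ , z~m , m~x , _ , l , _) , inj₁ refl) →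
             inj₁ (here refl , λ i → l i , ∈-commonNeighbours⁺ (z~m i) (m~x i))
         ; {z , ms} ((z~m₀ , z~m , m~x , _ , l , l₀) , inj₂ (j , refl)) →
             inj₂ ((l₀ j , ∈-commonNeighbours⁺ (~-sym z~m₀) (z~m j))
                  , λ i → l i , ∈-commonNeighbours⁺ (z~m i) (m~x i)) })
      (cover-∪ (cover-weaken (≤-reflexive (*-identityˡ _)) (cover-Σ (cover-∈ (u ∷ [])) legs))
               (cover-Σ (cover-light m₀ u) legs))

  untouched-broom : ∀ {m us} xs → Rich m xs → length us ≤ K →
                    ∃[ z ] ∃[ ms ] (Broom m xs (z , ms) × Avoids us z ms)
  untouched-broom {m} {us} xs rich us≤ = extract (survivor (λ b → touches? b us)
    (brooms-unique m xs) (few-touching-brooms m xs us us≤) (<-≤-trans R-large rich))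
    where
    extract : ∃[ b ] (b ∈ brooms m xs × ¬ Any (Touches b) us) →
              ∃[ z ] ∃[ ms ] (Broom m xs (z , ms) × Avoids us z ms)
    extract ((z , ms) , b∈ , ¬t) = z , ms , ∈-brooms⁻ xs b∈ , ¬touches⇒avoids ms ¬t

  few-rich : ∀ y (xs : Vec V s′) → Distinct (y ∷ xs) → ∀ {us} → Unique us →
    (∀ {m} → m ∈ us → y ~ m × Rich m xs) → length us ≤ K
  few-rich y xs dist {us} u rich = ≮⇒≥ λ K< → no-spiders {y ∷ xs} dist (next K<)
    where
    next : K < length us → ∀ vs → length vs ≤ K →
           ∃[ z ] ∃[ ms ] (Spider z ms (y ∷ xs) × Avoids vs z ms)
    next K< vs vs≤ = extend (survivor (λ x → any? (x Fin.≟_) vs) u (cover-⊆ proj₂ (cover-∈ vs))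
                               (≤-<-trans vs≤ K<))
      where
      attach : ∀ {m} → y ~ m → m ∉ vs → ∃[ z ] ∃[ ms ] (Broom m xs (z , ms) × Avoids vs z ms) →
               ∃[ z ] ∃[ ms ] (Spider z ms (y ∷ xs) × Avoids vs z ms)
      attach {m} y~m m∉ (z , ms , (z~m , z~ms , ms~xs , d , _) , z∉ , ms∉) =
        z , m ∷ ms
        , ((λ { zero → z~m ; (suc i) → z~ms i }) , (λ { zero → ~-sym y~m ; (suc i) → ms~xs i }) , d)
        , z∉ , (λ { zero → m∉ ; (suc i) → ms∉ i })
      extend : ∃[ m ] (m ∈ us × m ∉ vs) → ∃[ z ] ∃[ ms ] (Spider z ms (y ∷ xs) × Avoids vs z ms)
      extend (m , m∈ , m∉) = attach (proj₁ (rich m∈)) m∉ (untouched-broom xs (proj₂ (rich m∈)) vs≤)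

  -- Good spiders and their number for given ends.

  Good : V × Vec V s × Vec V s → Set
  Good (z , ms , xs) = Spider z ms xs × Distinct xs × (∀ i → ¬ Heavy z (lookup xs i)) ×
    (∀ {i j} → i ≢ j → ¬ Heavy (lookup ms i) (lookup ms j)) ×
    (∀ i → ¬ Rich (lookup ms i) (removeAt xs i))

  -- Forgetting the end of leg `i` turns a good spider into a broom, so that non-richness bounds the
  -- good spiders with given ends whose `i`-th midpoint is prescribed.
  good⇒broom : ∀ z ms xs → Good (z , ms , xs) → ∀ i →
               Broom (lookup ms i) (removeAt xs i) (z , removeAt ms i)
  good⇒broom z ms xs ((z~m , m~x , d) , _ , l , l′ , _) i =
    z~m i ,
    (λ j → subst (z ~_) (sym (lookup-removeAt ms i j)) (z~m _)) ,
    (λ j → subst₂ _~_ (sym (lookup-removeAt ms i j)) (sym (lookup-removeAt xs i j)) (m~x _)) ,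
    distinct-∷ (λ j eq → Fin.punchInᵢ≢i i j (d _ _ (trans (sym (lookup-removeAt ms i j)) eq)))
      (λ j k eq → Fin.punchIn-injective i j k
        (d _ _ (trans (sym (lookup-removeAt ms i j)) (trans eq (lookup-removeAt ms i k))))) ,
    (λ j → subst (λ x → ¬ Heavy z x) (sym (lookup-removeAt xs i j)) (l _)) ,
    (λ j → subst (λ m → ¬ Heavy (lookup ms i) m) (sym (lookup-removeAt ms i j))
      (l′ (Fin.punchInᵢ≢i i j ∘ sym)))

  -- Good spiders with ends `xs` that meet a vertex `v`: at most `L ^ s` have centre `v`, by
  -- lightness, and for each of the `s` legs at most `R` have midpoint `v`, since `v` is not rich.
  -- Beyond `K` times this total, some spider avoids any `K` vertices.
  few-good : ∀ xs {σs} → Unique σs → (∀ {σ} → σ ∈ σs → Good σ × proj₂ (proj₂ σ) ≡ xs) →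
             length σs ≤ K * (L ^ s + s * R)
  few-good xs {σs} u good = ≮⇒≥ λ lt → no-spiders {xs} (distinct lt) (next lt)
    where
    distinct : K * (L ^ s + s * R) < length σs → Distinct xs
    -- Any one of the spiders shows that the ends are distinct; the strict inequality provides one.
    distinct lt = case nonempty σs (≤-<-trans z≤n lt) of λ (σ , σ∈) →
      case good σ∈ of λ { ((_ , dist , _) , refl) → dist }

    touching : ∀ v → Cover (λ (z , ms , xs′) → (Good (z , ms , xs′) × xs′ ≡ xs) × Touches (z , ms) v)
                           (L ^ s + s * R)
    touching v = cover-image {P = λ (z , ms) → Good (z , ms , xs) × Touches (z , ms) v}
      (λ (z , ms) → z , ms , xs) (λ { {z , ms , _} ((g , refl) , t) → (z , ms) , refl , g , t })
      (cover-⊆ {Q = λ (z , ms) →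
            (z ∈ v ∷ [] × (∀ i → ¬ Heavy z (lookup xs i) × lookup ms i ∈ commonNeighbours z (lookup xs i))) ⊎
            ∃[ i ] (¬ Rich v (removeAt xs i) × Broom v (removeAt xs i) (z , removeAt ms i) × lookup ms i ≡ v)}
        (λ { {z , ms} (((z~m , m~x , _) , _ , l , _) , inj₁ refl) →
               inj₁ (here refl , λ i → l i , ∈-commonNeighbours⁺ (z~m i) (m~x i))
           ; {z , ms} (g@(_ , _ , _ , _ , ¬rich) , inj₂ (i , refl)) →
               inj₂ (i , ¬rich i , good⇒broom z ms xs g i , refl) })
        (cover-∪
          (cover-weaken (≤-reflexive (*-identityˡ _))
            (cover-Σ (cover-∈ (v ∷ [])) λ z → cover-Vec λ i → cover-light z (lookup xs i)))
          (cover-∃Fin λ i → cover-guard (¬? (rich? v (removeAt xs i))) λ ¬rich →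
            cover-weaken (<⇒≤ (≰⇒> ¬rich)) (cover-image {P = _∈ brooms v (removeAt xs i)}
              (λ (z , ms) → z , insertAt ms i v)
              (λ { {z , ms} (b , refl) → (z , removeAt ms i)
                   , cong (z ,_) (Vec.insertAt-removeAt ms i) , ∈-brooms⁺ (removeAt xs i) b })
              (cover-∈ (brooms v (removeAt xs i)))))))

    next : K * (L ^ s + s * R) < length σs → ∀ vs → length vs ≤ K →
           ∃[ z ] ∃[ ms ] (Spider z ms xs × Avoids vs z ms)
    next lt vs vs≤ = extract (survivor (λ (z , ms , _) → touches? (z , ms) vs) u
      (cover-weaken (*-monoˡ-≤ _ vs≤) (cover-⊆
        (λ { {z , ms , _} (σ∈ , t) → case find t of λ (v , v∈ , tv) → v , v∈ , good σ∈ , tv })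
        (cover-∃∈ vs (λ {v} _ → touching v)))) lt)
      where
      extract : ∃[ σ ] (σ ∈ σs × ¬ Any (Touches (proj₁ σ , proj₁ (proj₂ σ))) vs) →
                ∃[ z ] ∃[ ms ] (Spider z ms xs × Avoids vs z ms)
      extract ((z , ms , _) , σ∈ , ¬t) = case good σ∈ of λ
        { ((sp , _) , refl) → z , ms , sp , ¬touches⇒avoids ms ¬t }

  -- A walk is a spider with possibly coinciding vertices, along the arcs given
  -- by out.
  module Walks {Q q : ℕ} (2s≤q : 2 * s ≤ q) {vs : List V} (vs-unique : Unique vs)
    (out : V → List V) (out-unique : ∀ v → Unique (out v))
    (out-length : ∀ {v} → v ∈ vs → length (out v) ≡ Q * q) (out≤ : ∀ v → length (out v) ≤ Q * q)
    (out-~ : ∀ {v w} → w ∈ out v → v ~ w) (out⊆vs : ∀ {v w} → w ∈ out v → w ∈ vs) where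

    -- `c` is the bound of `few-popular` before any leaf is chosen, and `T` bounds the choices of
    -- `s′` legs from a given centre.
    d N c T : ℕ
    d = Q * q
    N = length vs
    c = (2 * Q) ^ s * K
    T = d ^ s′ * d ^ s′

    -- As `out v` has at most `Q * q` entries, `u` is heavy with at least a proportion 1/Q of them.
    Popular : V → V → Set
    Popular v u = q ≤ length (filter (heavy? u) (out v))

    popular? : ∀ v u → Dec (Popular v u)
    popular? v u = q ≤? length (filter (heavy? u) (out v))

    cover-popular : ∀ v → Cover (Popular v) c
    cover-popular v = mkCover (filter (popular? v) (allFin n))
      (few-popular {Q} {q} (out-unique v) 2s≤q (out≤ v) s [] (+-identityʳ s) (λ ())
        (Unique.filter⁺ (popular? v) (Unique.allFin⁺ n)) (λ _ ())
        (λ u∈ → proj₂ (∈-filter⁻ (popular? v) {xs = allFin n} u∈)))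
      (λ {u} p → ∈-filter⁺ (popular? v) (∈-allFin u) p)

    Legs : ∀ {k} → V → Vec V k × Vec V k → Set
    Legs y (ms , xs) = (∀ i → lookup ms i ∈ out y) × (∀ i → lookup xs i ∈ out (lookup ms i))

    Walk : V × Vec V s × Vec V s → Set
    Walk (y , legs) = y ∈ vs × Legs y legs

    cover-out : ∀ v → Cover (_∈ out v) d
    cover-out v = cover-weaken (out≤ v) (cover-∈ (out v))

    cover-legs : ∀ y → Cover (Legs {s′} y) T
    cover-legs y = cover-Σ {P = λ ms → ∀ i → lookup ms i ∈ out y}
      (cover-Vec λ _ → cover-out y) (λ ms → cover-Vec λ i → cover-out (lookup ms i))

    legs-removeAt : ∀ {y} (ms xs : Vec V s) i → Legs y (ms , xs) → Legs y (removeAt ms i , removeAt xs i)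
    legs-removeAt {y} ms xs i (ms∈ , xs∈) =
      (λ j → subst (_∈ out y) (sym (lookup-removeAt ms i j)) (ms∈ _)) ,
      (λ j → subst₂ (λ x m → x ∈ out m) (sym (lookup-removeAt xs i j)) (sym (lookup-removeAt ms i j))
        (xs∈ _))

    walks : List (V × Vec V s × Vec V s)
    walks = sigma vs λ y → sigma (choices (replicate s (out y))) λ ms → choices (Vec.map out ms)

    walks-unique : Unique walks
    walks-unique = sigma-unique vs-unique λ y → sigma-unique
      (choices-unique (replicate s (out y)) λ i →
        subst Unique (sym (Vec.lookup-replicate i (out y))) (out-unique y))
      (λ ms → choices-unique (Vec.map out ms) λ i →
        subst Unique (sym (Vec.lookup-map i out ms)) (out-unique _))

    ms∈⁻ : ∀ {y ms} → ms ∈ choices (replicate s (out y)) → ∀ i → lookup ms i ∈ out y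
    ms∈⁻ {y} {ms} ms∈ i = subst (lookup ms i ∈_) (Vec.lookup-replicate i (out y))
      (∈-choices⁻ (replicate s (out y)) ms∈ i)

    walks-length : length walks ≡ N * (d ^ s * d ^ s)
    walks-length = length-sigma vs λ {y} y∈ → trans
      (length-sigma (choices (replicate s (out y))) λ {ms} ms∈ → length-choices (Vec.map out ms) λ i →
        trans (cong length (Vec.lookup-map i out ms)) (out-length (out⊆vs (ms∈⁻ ms∈ i))))
      (cong (_* d ^ s) (length-choices (replicate s (out y)) λ i →
        trans (cong length (Vec.lookup-replicate i (out y))) (out-length y∈)))

    walks⇒Walk : ∀ {σ} → σ ∈ walks → Walk σ
    walks⇒Walk {y , ms , xs} σ∈ =
      proj₁ (∈-sigma⁻ vs σ∈) , ms∈⁻ (proj₁ legs∈) ,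
      (λ i → subst (lookup xs i ∈_) (Vec.lookup-map i out ms)
        (∈-choices⁻ (Vec.map out ms) (proj₂ legs∈) i))
      where
      legs∈ : ms ∈ choices (replicate s (out y)) × xs ∈ choices (Vec.map out ms)
      legs∈ = ∈-sigma⁻ (choices (replicate s (out y))) (proj₂ (∈-sigma⁻ vs σ∈))

    -- Here `ms` and `xs` describe the other legs. The guards keep the clauses small: an unpopular
    -- midpoint is heavy with fewer than `q` out-neighbours of `y`, and `few-rich` needs distinct
    -- ends.
    BadMid : ∀ (y : V) (ms xs : Vec V s′) → V → Set
    BadMid y ms xs m = Popular y m ⊎ (∃[ k ] m ≡ lookup ms k) ⊎
      (∃[ k ] (¬ Popular y (lookup ms k) × Heavy (lookup ms k) m)) ⊎ (Distinct (y ∷ xs) × Rich m xs)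

    BadEnd : ∀ (y : V) (xs : Vec V s′) → V → V → Set
    BadEnd y xs m x = x ≡ y ⊎ (∃[ k ] x ≡ lookup xs k) ⊎ (¬ Popular m y × Heavy y x)

    badMid? : ∀ y ms xs m → Dec (BadMid y ms xs m)
    badMid? y ms xs m = popular? y m ⊎-dec Fin.any? (λ k → m Fin.≟ lookup ms k) ⊎-dec
      Fin.any? (λ k → ¬? (popular? y (lookup ms k)) ×-dec heavy? (lookup ms k) m) ⊎-dec
      (distinct? (y ∷ xs) ×-dec rich? m xs)

    badEnd? : ∀ y xs m x → Dec (BadEnd y xs m x)
    badEnd? y xs m x = (x Fin.≟ y) ⊎-dec Fin.any? (λ k → x Fin.≟ lookup xs k) ⊎-dec
      (¬? (popular? m y) ×-dec heavy? y x)

    cover-heavy : ∀ v u → Cover (λ w → ¬ Popular v u × w ∈ out v × Heavy u w) q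
    cover-heavy v u = cover-guard (¬? (popular? v u)) λ ¬p → cover-weaken (<⇒≤ (≰⇒> ¬p))
      (cover-⊆ (λ (w∈ , h) → ∈-filter⁺ (heavy? u) w∈ h) (cover-∈ (filter (heavy? u) (out v))))

    cover-≡ : ∀ (u : V) → Cover (_≡ u) 1
    cover-≡ u = mkCover (u ∷ []) ≤-refl here

    -- The summands count popular vertices, repeated midpoints, vertices heavy with one of the `s′`
    -- other midpoints, and rich vertices.
    few-bad-mids : ∀ y ms xs → Cover (λ m → m ∈ out y × BadMid y ms xs m) (c + (s′ * 1 + (s′ * q + K)))
    few-bad-mids y ms xs = cover-⊆
      (λ { (_  , inj₁ p)                       → inj₁ p
         ; (_  , inj₂ (inj₁ eq))               → inj₂ (inj₁ eq)
         ; (m∈ , inj₂ (inj₂ (inj₁ (k , ¬p , h)))) → inj₂ (inj₂ (inj₁ (k , ¬p , m∈ , h)))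
         ; (m∈ , inj₂ (inj₂ (inj₂ (dist , r)))) → inj₂ (inj₂ (inj₂ (dist , m∈ , r))) })
      (cover-∪ (cover-popular y) (cover-∪ (cover-∃Fin (λ k → cover-≡ (lookup ms k)))
        (cover-∪ (cover-∃Fin (λ k → cover-heavy y (lookup ms k)))
          (cover-guard (distinct? (y ∷ xs)) λ dist → mkCover (filter (λ m → rich? m xs) (out y))
            (few-rich y xs dist (Unique.filter⁺ _ (out-unique y)) λ m∈ → filtered m∈)
            (λ (m∈ , r) → ∈-filter⁺ (λ m → rich? m xs) m∈ r)))))
      where
      filtered : ∀ {m} → m ∈ filter (λ m → rich? m xs) (out y) → y ~ m × Rich m xs
      filtered m∈ = out-~ (proj₁ (∈-filter⁻ (λ m → rich? m xs) m∈)) ,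
                    proj₂ (∈-filter⁻ (λ m → rich? m xs) {xs = out y} m∈)

    few-bad-ends : ∀ y xs m → Cover (λ x → x ∈ out m × BadEnd y xs m x) (1 + (s′ * 1 + q))
    few-bad-ends y xs m = cover-⊆
      (λ { (_  , inj₁ eq)              → inj₁ eq
         ; (_  , inj₂ (inj₁ eq))       → inj₂ (inj₁ eq)
         ; (x∈ , inj₂ (inj₂ (¬p , h))) → inj₂ (inj₂ (¬p , x∈ , h)) })
      (cover-∪ (cover-≡ y) (cover-∪ (cover-∃Fin (λ k → cover-≡ (lookup xs k))) (cover-heavy m y)))

    -- A bad midpoint followed by any end, or any midpoint followed by a bad end.
    b : ℕ
    b = (c + (s′ * 1 + (s′ * q + K))) * d + d * (1 + (s′ * 1 + q))

    few-bad-legs : ∀ y ms xs →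
      Cover (λ (m , x) → (m ∈ out y × x ∈ out m) × (BadMid y ms xs m ⊎ BadEnd y xs m x)) b
    few-bad-legs y ms xs = cover-⊆
      (λ { {m , x} ((m∈ , x∈) , inj₁ bad) → inj₁ ((m∈ , bad) , x∈)
         ; {m , x} ((m∈ , x∈) , inj₂ bad) → inj₂ (m∈ , (x∈ , bad)) })
      (cover-∪ (cover-Σ (few-bad-mids y ms xs) cover-out) (cover-Σ (cover-out y) (few-bad-ends y xs)))

    -- Whether m is popular for the centre y is not controlled by y alone:
    -- such walks are counted over all centres at once.
    PopularAt BadAt : Fin s → V × Vec V s × Vec V s → Set
    PopularAt i (y , ms , xs) = Popular (lookup ms i) y
    BadAt i (y , ms , xs) = BadMid y (removeAt ms i) (removeAt xs i) (lookup ms i) ⊎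
                            BadEnd y (removeAt xs i) (lookup ms i) (lookup xs i)

    Bad : V × Vec V s × Vec V s → Set
    Bad σ = (∃[ i ] PopularAt i σ) ⊎ (∃[ i ] BadAt i σ)

    bad? : Decidable Bad
    bad? (y , ms , xs) = Fin.any? (λ i → popular? (lookup ms i) y) ⊎-dec
      Fin.any? (λ i → badMid? y (removeAt ms i) (removeAt xs i) (lookup ms i) ⊎-dec
                      badEnd? y (removeAt xs i) (lookup ms i) (lookup xs i))

    -- For `PopularAt` the midpoint is chosen first, in `N` ways, then one of at most `c` centres
    -- popular for it, the end of that leg and the other legs. For `BadAt` the leg in question is
    -- chosen last, after the centre and the other legs.
    few-bad : Cover (λ σ → σ ∈ walks × Bad σ) (s * (N * c * (d * T)) + s * (N * (T * b)))
    few-bad = cover-⊆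
      (λ { (σ∈ , inj₁ (i , p)) → inj₁ (i , walks⇒Walk σ∈ , p)
         ; (σ∈ , inj₂ (i , p)) → inj₂ (i , walks⇒Walk σ∈ , p) })
      (cover-∪ (cover-∃Fin popular-at) (cover-∃Fin bad-at))
      where
      insert≡ : ∀ y ms xs (i : Fin s) →
        (y , insertAt (removeAt ms i) i (lookup ms i) , insertAt (removeAt xs i) i (lookup xs i)) ≡
        (y , ms , xs)
      insert≡ y ms xs i = cong₂ (λ ms xs → y , ms , xs)
        (Vec.insertAt-removeAt ms i) (Vec.insertAt-removeAt xs i)

      popular-at : ∀ i → Cover (λ σ → Walk σ × PopularAt i σ) (N * c * (d * T))
      popular-at i = cover-image (λ ((m , y) , x , ms , xs) → y , insertAt ms i m , insertAt xs i x)
        (λ { {y , ms , xs} ((y∈ , legs) , p) →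
               ((lookup ms i , y) , lookup xs i , removeAt ms i , removeAt xs i)
             , insert≡ y ms xs i
             , (out⊆vs (proj₁ legs i) , p) , proj₂ legs i , legs-removeAt ms xs i legs })
        (cover-Σ (cover-Σ (cover-∈ vs) cover-popular)
          (λ (m , y) → cover-Σ (cover-out m) (λ _ → cover-legs y)))

      bad-at : ∀ i → Cover (λ σ → Walk σ × BadAt i σ) (N * (T * b))
      bad-at i = cover-image (λ (y , (ms , xs) , (m , x)) → y , insertAt ms i m , insertAt xs i x)
        (λ { {y , ms , xs} ((y∈ , legs) , bad) →
               (y , (removeAt ms i , removeAt xs i) , (lookup ms i , lookup xs i))
             , insert≡ y ms xs i
             , y∈ , legs-removeAt ms xs i legs , (proj₁ legs i , proj₂ legs i) , bad })
        (cover-Σ (cover-∈ vs) (λ y → cover-Σ (cover-legs y) (λ (ms , xs) → few-bad-legs y ms xs)))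

    -- The guards in `BadMid` and `BadEnd` are discharged by other clauses: unpopularity is itself
    -- part of not being bad, and distinctness of `y` and the other ends follows from the first two
    -- clauses of `BadEnd`.
    ¬bad⇒good : ∀ y ms xs → Walk (y , ms , xs) → ¬ Bad (y , ms , xs) → Good (y , ms , xs)
    ¬bad⇒good y ms xs (_ , ms∈ , xs∈) ¬bad =
      ((λ i → out-~ (ms∈ i)) , (λ i → out-~ (xs∈ i)) , distinct-ms) , distinct-xs ,
      (λ i h → ¬end i (inj₂ (inj₂ (¬popular i , h)))) ,
      (λ {i} {j} i≢j h → ¬mid j (inj₂ (inj₂ (inj₁ (punchOut (i≢j ∘ sym) ,
        subst (λ m → ¬ Popular y m × Heavy m (lookup ms j)) (sym (Vec.removeAt-punchOut ms (i≢j ∘ sym)))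
          (¬mid i ∘ inj₁ , h)))))) ,
      (λ i r → ¬mid i (inj₂ (inj₂ (inj₂
        (distinct-∷ (λ j eq → ¬end (punchIn i j) (inj₁ (trans (sym (lookup-removeAt xs i j)) eq)))
          (λ j k eq → Fin.punchIn-injective i j k (distinct-xs _ _
            (trans (sym (lookup-removeAt xs i j)) (trans eq (lookup-removeAt xs i k))))) , r)))))
      where
      ¬popular : ∀ i → ¬ PopularAt i (y , ms , xs)
      ¬popular i p = ¬bad (inj₁ (i , p))
      ¬mid : ∀ i → ¬ BadMid y (removeAt ms i) (removeAt xs i) (lookup ms i)
      ¬mid i p = ¬bad (inj₂ (i , inj₁ p))
      ¬end : ∀ i → ¬ BadEnd y (removeAt xs i) (lookup ms i) (lookup xs i)
      ¬end i p = ¬bad (inj₂ (i , inj₂ p))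
      distinct-ms : Distinct ms
      distinct-ms i j eq with i Fin.≟ j
      ... | yes i≡j = i≡j
      ... | no  i≢j with () ← ¬mid i (inj₂ (inj₁
                      (punchOut i≢j , trans eq (sym (Vec.removeAt-punchOut ms i≢j)))))
      distinct-xs : Distinct xs
      distinct-xs i j eq with i Fin.≟ j
      ... | yes i≡j = i≡j
      ... | no  i≢j with () ← ¬end i (inj₂ (inj₁
                      (punchOut i≢j , trans eq (sym (Vec.removeAt-punchOut xs i≢j)))))

    -- Comparing all walks with the good ones.

    good-walks : List (V × Vec V s × Vec V s)
    good-walks = filter (¬? ∘ bad?) walks

    -- All ends lie in `vs`, so there are `N ^ s` tuples of ends, and `few-good` bounds the good
    -- walks over each.
    good-walks-length : length good-walks ≤ N ^ s * (K * (L ^ s + s * R))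
    good-walks-length = ≮⇒≥ λ lt → absurd (pigeonhole (Vec.≡-dec Fin._≟_) (proj₂ ∘ proj₂) unique ends∈
      (subst (λ l → l * (K * (L ^ s + s * R)) < length good-walks) (sym ends-length) lt))
      where
      unique : Unique good-walks
      unique = Unique.filter⁺ (¬? ∘ bad?) walks-unique

      ∈⁻ : ∀ {σ} → σ ∈ good-walks → σ ∈ walks × ¬ Bad σ
      ∈⁻ = ∈-filter⁻ (¬? ∘ bad?)

      ends : List (Vec V s)
      ends = choices (replicate s vs)

      ends-length : length ends ≡ N ^ s
      ends-length = length-choices (replicate s vs) (λ i → cong length (Vec.lookup-replicate i vs))

      ends∈ : ∀ {σ} → σ ∈ good-walks → proj₂ (proj₂ σ) ∈ ends
      ends∈ {y , ms , xs} σ∈ = ∈-choices⁺ (replicate s vs) λ i →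
        subst (lookup xs i ∈_) (sym (Vec.lookup-replicate i vs))
          (out⊆vs (proj₂ (proj₂ (walks⇒Walk (proj₁ (∈⁻ σ∈)))) i))

      absurd : ¬ (∃[ xs ] (K * (L ^ s + s * R) <
                  length (filter (λ σ → Vec.≡-dec Fin._≟_ (proj₂ (proj₂ σ)) xs) good-walks)))
      absurd (xs , many) = <⇒≱ many (few-good xs (Unique.filter⁺ ends≟ unique) good)
        where
        ends≟ : Decidable (λ (σ : V × Vec V s × Vec V s) → proj₂ (proj₂ σ) ≡ xs)
        ends≟ σ = Vec.≡-dec Fin._≟_ (proj₂ (proj₂ σ)) xs
        good : ∀ {σ} → σ ∈ filter ends≟ good-walks → Good σ × proj₂ (proj₂ σ) ≡ xs
        good {y , ms , xs} σ∈ =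
          ¬bad⇒good y ms xs (walks⇒Walk (proj₁ (∈⁻ σ∈′))) (proj₂ (∈⁻ σ∈′)) ,
          proj₂ (∈-filter⁻ ends≟ {xs = good-walks} σ∈)
          where
          σ∈′ : (y , ms , xs) ∈ good-walks
          σ∈′ = proj₁ (∈-filter⁻ ends≟ σ∈)

    walks-bound : N * (d ^ s * d ^ s) ≤
      s * (N * c * (d * T)) + s * (N * (T * b)) + N ^ s * (K * (L ^ s + s * R))
    walks-bound = ≤-trans (≤-reflexive (sym walks-length))
      (≤-trans (survivors bad? walks-unique few-bad) (+-monoʳ-≤ _ good-walks-length))

  -- At least half of the `N * d ^ (2 * s)` walks are good, while good walks number at most a
  -- constant times `N ^ s`. Cancelling one `N` and using `N ≤ n` gives the bound.
  sparse : ∀ {q ws} → let Q = 2 * s * suc s ; c = (2 * Q) ^ s * K in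
    2 * c + K + 1 + 2 * s′ ≤ q → 2 * s ≤ q → Unique ws → 0 < length ws →
    (∀ {w} → w ∈ ws → Q * q ≤ length (neighboursIn G ws w)) →
    (Q * q) ^ s * (Q * q) ^ s ≤ 2 * (K * (L ^ s + s * R)) * n ^ s′
  sparse {q} {ws} A≤q 2s≤q ws-unique 0<N degree =
    *-cancelˡ-≤ N ⦃ >-nonZero 0<N ⦄ (begin
      N * (d ^ s * d ^ s)
        ≤⟨ x≤y+z∧2y≤x⇒x≤2z {y = s * (N * c * (d * T)) + s * (N * (T * b))} {z = N ^ s * M} walks-bound
             (≤-trans (bad-walks-half s′ q N c K T A≤q) (≤-reflexive (expand N d (d ^ s′)))) ⟩
      2 * (N ^ s * M)
        ≡⟨ regroup N (N ^ s′) M ⟩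
      N * (2 * M * N ^ s′)
        ≤⟨ *-monoʳ-≤ N (*-monoʳ-≤ (2 * M) (^-monoˡ-≤ s′ N≤n)) ⟩
      N * (2 * M * n ^ s′) ∎)
    where
    open ≤-Reasoning
    out : V → List V
    -- Truncation makes the number of walks exact and caps the bad choices. It need not preserve
    -- symmetry, hence arcs instead of edges.
    out v = take (2 * s * suc s * q) (neighboursIn G ws v)
    out⁻ : ∀ {v w} → w ∈ out v → w ∈ ws × v ~ w
    out⁻ {v} w∈ = ∈-filter⁻ (v ~?_)
      (All.lookup (All.take⁺ (2 * s * suc s * q) (All.tabulate {xs = neighboursIn G ws v} id)) w∈)
    open Walks {Q = 2 * s * suc s} 2s≤q ws-unique out
      (λ v → Unique.take⁺ (2 * s * suc s * q) (Unique.filter⁺ (v ~?_) ws-unique))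
      (λ {v} v∈ → trans (List.length-take (2 * s * suc s * q) (neighboursIn G ws v))
                        (m≤n⇒m⊓n≡m (degree v∈)))
      (λ v → ≤-trans (≤-reflexive (List.length-take (2 * s * suc s * q) (neighboursIn G ws v)))
                     (m⊓n≤m _ _))
      (λ w∈ → proj₂ (out⁻ w∈)) (λ w∈ → proj₁ (out⁻ w∈))
    M : ℕ
    M = K * (L ^ s + s * R)
    N≤n : N ≤ n
    N≤n = ≤-trans (unique-⊆ ws-unique (λ _ → ∈-allFin _))
            (≤-reflexive (List.length-tabulate {n = n} id))
    expand : ∀ N d e → N * (d * (d * (e * e))) ≡ N * (d * e * (d * e))
    expand = solve-∀
    regroup : ∀ N e M → 2 * (N * e * M) ≡ N * (2 * M * e)
    regroup = solve-∀

-- The exponent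

module _ (s′ t : ℕ) where

  private
    -- `Q` is the factor with `d = Q * q` in `bad-walks-half` and `A` its threshold for `q`. `B`
    -- dominates both lower bounds required of `q` and also `2 * M`, which `B ^ h` therefore
    -- absorbs.
    s h K L R Q c A M B : ℕ
    s = suc s′
    h = s + s
    K = s + t * suc s
    L = K + s
    R = suc (K * (L ^ s′ + L * L ^ s′))
    Q = 2 * s * suc s
    c = (2 * Q) ^ s * K
    A = 2 * c + K + 1 + 2 * s′
    M = K * (L ^ s + s * R)
    B = A + 2 * s + 2 * M

  -- `2 * Q` is the price of passing from edges to minimum degree `Q * q`; the 2 before `B` absorbs
  -- the rounding of `q`.
  C : ℕ
  C = 2 * Q * (2 * B)

  private
    A≤B : A ≤ B
    A≤B = ≤-trans (m≤m+n A (2 * s)) (m≤m+n (A + 2 * s) (2 * M))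

    2s≤B : 2 * s ≤ B
    2s≤B = ≤-trans (m≤n+m (2 * s) A) (m≤m+n (A + 2 * s) (2 * M))

    0<B : 0 < B
    0<B = ≤-trans (s≤s z≤n) 2s≤B

  -- A subgraph of minimum degree `Q * q` is extracted and `sparse` applied to it.
  sparse-edges : ∀ n → 1 ≤ n → (G : Graph (Fin n)) → G FreeOf FiniteGraph.graph (K′ s t) →
    ∀ q → 2 * Q * n * q < edges G → B ≤ q → q ^ h ≤ B ^ h * n ^ s′
  sparse-edges n 1≤n G free q many B≤q = conclude
    (min-degree-sublist G (Q * q) (length (allFin n)) (allFin n) ≤-refl (Unique.allFin⁺ n) dense)
    where
    open ≤-Reasoning
    rearrange : ∀ Q q n → 2 * (Q * q) * n ≡ 2 * Q * n * q
    rearrange = solve-∀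
    dense : 2 * (Q * q) * length (allFin n) < length (adjacentPairs G (allFin n))
    dense = begin-strict
      2 * (Q * q) * length (allFin n)  ≡⟨ cong (2 * (Q * q) *_) (List.length-tabulate {n = n} id) ⟩
      2 * (Q * q) * n                  ≡⟨ rearrange Q q n ⟩
      2 * Q * n * q                    <⟨ many ⟩
      edges G                          ≤⟨ edges≤adjacentPairs G ⟩
      length (adjacentPairs G (allFin n)) ∎
    conclude : ∃[ ws ] (Unique ws × 0 < length ws ×
                        (∀ {w} → w ∈ ws → Q * q ≤ length (neighboursIn G ws w))) →
               q ^ h ≤ B ^ h * n ^ s′
    conclude (ws , ws-unique , 0<N , degree) = begin
      q ^ h                      ≤⟨ ^-monoˡ-≤ h (m≤n*m q Q) ⟩
      (Q * q) ^ h                ≡⟨ ^-distribˡ-+-* (Q * q) s s ⟩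
      (Q * q) ^ s * (Q * q) ^ s  ≤⟨ SpiderFree.sparse G s′ t K L R ≤-refl ≤-refl ≤-refl free
                                      (≤-trans A≤B B≤q)
                                      (≤-trans 2s≤B B≤q)
                                      ws-unique 0<N degree ⟩
      2 * M * n ^ s′             ≤⟨ *-monoˡ-≤ (n ^ s′) (≤-trans (m≤n+m (2 * M) (A + 2 * s))
                                                         (m≤m^k B h ⦃ >-nonZero 0<B ⦄)) ⟩
      B ^ h * n ^ s′             ∎

  -- With `q` about `edges G / (2 * Q * n)`, either `2 * Q * suc q` already obeys the bound or `q`
  -- is too large for `sparse-edges`. The power `h + h = 4 * s` is the unreduced denominator of the
  -- exponent.
  edges-bound : ∀ n → 1 ≤ n → (G : Graph (Fin n)) → G FreeOf FiniteGraph.graph (K′ s t) →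
    edges G ^ (h + h) ≤ (C ^ h * n ^ s′) * (C ^ h * n ^ s′) * (n ^ h * n ^ h)
  edges-bound n@(suc _) 1≤n G free with edges G in eq
  ... | zero  = power-bound {y = 0} {n} {C ^ h * n ^ s′} h z≤n z≤n
  ... | suc x with q , lower , upper ← quotient (2 * Q * n) x
              with (2 * Q * suc q) ^ h ≤? C ^ h * n ^ s′
  ...   | yes small = power-bound {y = 2 * Q * suc q} {n} {C ^ h * n ^ s′} h
                        (≤-trans upper (≤-reflexive (swap₂₃ (2 * Q) n (suc q)))) small
    where
    swap₂₃ : ∀ a b c → a * b * c ≡ a * c * b
    swap₂₃ = solve-∀
  ...   | no ¬small = ⊥-elim (<⇒≱ excess
                        (sparse-edges n 1≤n G free q (subst (2 * Q * n * q <_) (sym eq) lower)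
                          (≤-trans (m≤n*m B 2) 2B≤q)))
    where
    open ≤-Reasoning
    excess₁ : (2 * B) ^ h * n ^ s′ < suc q ^ h
    excess₁ = cancel-power (2 * Q) (2 * B) (suc q) h (n ^ s′) (≰⇒> ¬small)
    -- The factor `n ^ s′` is at least 1, so `excess₁` alone forces `q` above the threshold of
    -- `sparse-edges`.
    2B≤q : 2 * B ≤ q
    2B≤q = ≮⇒≥ λ q<2B → <⇒≱ excess₁ (≤-trans (^-monoˡ-≤ h q<2B)
             (m≤m*n ((2 * B) ^ h) (n ^ s′) ⦃ m^n≢0 n s′ ⦄))
    1+q≤2q : suc q ≤ 2 * q
    1+q≤2q = ≤-trans (+-monoˡ-≤ q (≤-trans (≤-trans 0<B (m≤n*m B 2)) 2B≤q))
               (≤-reflexive (cong (λ r → q + r) (sym (+-identityʳ q))))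
    -- Replacing `suc q` by `2 * q` removes the rounding at the cost of the factor 2 in `2 * B`.
    excess : B ^ h * n ^ s′ < q ^ h
    excess = cancel-power 2 B q h (n ^ s′) (<-≤-trans excess₁ (^-monoˡ-≤ h 1+q≤2q))

  extremal-bound : ∀ n → 1 ≤ n → 1 ≤ t →
    ex n (K′ s t) ^ (h + h) ≤ C ^ (h + h) * n ^ (s′ + s′ + (h + h))
  -- `ex-attained` needs some free graph, so that the default value of `ex` causes no trouble; the
  -- edgeless graph is free because `K′ s t` has an edge once `t` is positive.
  extremal-bound n 1≤n 1≤t = from-extremal (ex-attained (K′ s t) empty (empty-free 1≤t))
    where
    empty : Graph (Fin n)
    empty = record { _~_ = λ _ _ → ⊥ ; ~-sym = id ; ~-irr = λ _ () ; _~?_ = λ _ _ → no id }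
    empty-free : 1 ≤ t → empty FreeOf FiniteGraph.graph (K′ s t)
    empty-free (s≤s _) copy = Copy.preserves copy (to-mid (left {i = zero} {zero}))
    swap-mid : ∀ a b c → a * a * (b * b * (c * c)) ≡ a * b * (a * b) * (c * c)
    swap-mid = solve-∀
    rearrange : C ^ (h + h) * n ^ (s′ + s′ + (h + h)) ≡
                (C ^ h * n ^ s′) * (C ^ h * n ^ s′) * (n ^ h * n ^ h)
    rearrange = trans (cong₂ _*_ (^-distribˡ-+-* C h h)
      (trans (^-distribˡ-+-* n (s′ + s′) (h + h))
        (cong₂ _*_ (^-distribˡ-+-* n s′ s′) (^-distribˡ-+-* n h h))))
      (swap-mid (C ^ h) (n ^ s′) (n ^ h))
    from-extremal : ∃[ G ] (G FreeOf FiniteGraph.graph (K′ s t) × edges {n} G ≡ ex n (K′ s t)) →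
            ex n (K′ s t) ^ (h + h) ≤ C ^ (h + h) * n ^ (s′ + s′ + (h + h))
    from-extremal (G , free , eq) =
      subst₂ (λ x e → x ^ (h + h) ≤ e) {y = ex n (K′ s t)} eq (sym rearrange) (edges-bound n 1≤n G free)

theorem1p8 : ∀ (s t : ℕ) (2≤s : 2 ≤ s) → s ≤ t →
    let instance _ = 2*-nonZero 2≤s in
    (λ n → ex n (K′ s t)) =O[n^ + 3 / 2 - + 1 / (2 * s) ]
theorem1p8 (suc s′@(suc r)) t (s≤s (s≤s _)) s≤t = C s′ t , 1 , λ n 1≤n →
  subst₂ (λ e p → ex n (K′ (suc s′) t) ^ e ≤ C s′ t ^ e * n ^ p) (denominator r) (numerator r)
    (extremal-bound s′ t n 1≤n (≤-trans (s≤s z≤n) s≤t))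
  where
  -- Unnormalised subtraction leaves the exponent as `3 * (2 * s) - 2` over `2 * (2 * s)`, without
  -- reduction.
  denominator : ∀ r → let s = suc (suc r) in s + s + (s + s) ≡ 2 * (2 * s)
  denominator = solve-∀
  6s≡ : ∀ r → let s = suc (suc r) in 3 * (2 * s) ≡ 2 + (suc r + suc r + (s + s + (s + s)))
  6s≡ = solve-∀
  numerator : ∀ r → let s = suc (suc r) in suc r + suc r + (s + s + (s + s)) ≡ 3 * (2 * s) ∸ 2
  numerator r = sym (cong (_∸ 2) (6s≡ r))
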